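{- For every fixed integer $s\ge 1$, as $n\to\infty$, $$\beta_s(n)=\frac{n^{2s}}{4^{s}}+\frac{s(2s-11)}{9\cdot 4^{s}}\,n^{2s-1}+O\!\left(n^{2s-2}\right),$$ where $\beta_s(n)=\sum_{k\ge 0}(k)_s\,\frac{I_{n,k}}{n!}$ is the $s$th factorial moment of the number of inversions of a uniformly random permutation of $\{1,\dots,n\}$.
   Context: $S_n$ is the set of all $n!$ permutations of $\{1,\dots,n\}$. In a permutation $\sigma=(a_1,a_2,\dots,a_n)$, a pair $(a_i,a_j)$ with $i<j$ is called an inversion if $a_i>a_j$. $I_{n,k}$ is the number of permutations in $S_n$ having exactly $k$ inversions. $(k)_s=k(k-1)\cdots(k-s+1)$ is the falling factorial, with $(k)_0=1$. The implied constant in $O(\cdot)$ may depend on $s$. -}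

module Defs where

open import Data.Nat.Base as ℕ using (ℕ; zero; suc; _!)
open import Data.Nat.Properties as ℕₚ using (_≟_; _!≢0)
open import Data.Nat.Combinatorics using (_P_)
open import Data.Integer.Base using (+_)
open import Data.Rational.Base using (ℚ; 0ℚ; _/_; _+_; _*_; _≤_; ∣_∣)
open import Data.Fin.Base using (Fin; _<_)
import Data.Fin.Properties as Fin
open import Data.List.Base
  using (List; []; _∷_; [_]; length; filter; map; foldr; upTo; allFin; cartesianProduct; cartesianProductWith)
open import Data.List.Properties using (length-filter; length-tabulate; length-++; length-map; filter-none)
import Data.List.Relation.Unary.All as All
open import Data.Vec.Base as Vec using (Vec; lookup)
open import Data.Vec.Relation.Unary.Unique.Propositional using (Unique)
import Data.Vec.Relation.Unary.AllPairs as AllPairs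
open import Data.Product.Base using (_×_; _,_; ∃-syntax)
open import Function.Base using (id)
open import Relation.Nullary.Decidable using (_×-dec_; ¬?)
open import Relation.Unary using (Decidable)
open import Relation.Binary.PropositionalEquality using (_≡_; refl; sym; trans; cong; cong₂)

-- All words of length m over the alphabet Fin n.
words : (n m : ℕ) → List (Vec (Fin n) m)
words n zero    = [ Vec.[] ]
words n (suc m) = cartesianProductWith Vec._∷_ (allFin n) (words n m)

unique? : ∀ {n m} → Decidable (Unique {A = Fin n} {n = m})
unique? = AllPairs.allPairs? (λ x y → ¬? (x Fin.≟ y))

-- A permutation of {1,…,n} is written in one-line notation (a₁,…,aₙ), as a
-- word of length n without repeated entries; Fin n stands for {1,…,n} with
-- its usual order.
permutations : (n : ℕ) → List (Vec (Fin n) n)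
permutations n = filter unique? (words n n)

Inversion : ∀ {n} → Vec (Fin n) n → Fin n × Fin n → Set
Inversion σ (i , j) = i < j × lookup σ j < lookup σ i

inversion? : ∀ {n} (σ : Vec (Fin n) n) → Decidable (Inversion σ)
inversion? σ (i , j) = (i Fin.<? j) ×-dec (lookup σ j Fin.<? lookup σ i)

pairs : (n : ℕ) → List (Fin n × Fin n)
pairs n = cartesianProduct (allFin n) (allFin n)

inversions : ∀ {n} → Vec (Fin n) n → ℕ
inversions {n} σ = length (filter (inversion? σ) (pairs n))

I : ℕ → ℕ → ℕ
I n k = length (filter (λ σ → inversions σ ≟ k) (permutations n))

fromℕ : ℕ → ℚ
fromℕ m = + m / 1

sumℚ : List ℚ → ℚ
sumℚ = foldr _+_ 0ℚ

-- The sum over all k ≥ 0 is cut off at k = n * n; the omitted terms vanish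
-- by I-support below.  The library's k P s is the falling factorial
-- k (k - 1) ⋯ (k - s + 1), which is 0 when k < s.
β : ℕ → ℕ → ℚ
β s n = sumℚ (map (λ k → fromℕ (k P s) * (+ I n k / n !)) (upTo (suc (n ℕ.* n))))
  where instance _ = n !≢0

length-cartesianProduct : ∀ {A B : Set} (xs : List A) (ys : List B) →
  length (cartesianProduct xs ys) ≡ length xs ℕ.* length ys
length-cartesianProduct []       ys = refl
length-cartesianProduct (x ∷ xs) ys =
  trans (length-++ (map (x ,_) ys))
        (cong₂ ℕ._+_ (length-map (x ,_) ys) (length-cartesianProduct xs ys))

inversions≤n*n : ∀ {n} (σ : Vec (Fin n) n) → inversions σ ℕ.≤ n ℕ.* n
inversions≤n*n {n} σ = begin
  inversions σ                              ≤⟨ length-filter (inversion? σ) (pairs n) ⟩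
  length (pairs n)                          ≡⟨ length-cartesianProduct (allFin n) (allFin n) ⟩
  length (allFin n) ℕ.* length (allFin n)   ≡⟨ cong₂ ℕ._*_ (length-tabulate {n = n} id) (length-tabulate {n = n} id) ⟩
  n ℕ.* n                                   ∎
  where open ℕₚ.≤-Reasoning

I-support : ∀ n k → n ℕ.* n ℕ.< k → I n k ≡ 0
I-support n k n*n<k = cong length (filter-none (λ σ → inversions σ ≟ k)
  (All.universal (λ σ → ℕₚ.<⇒≢ (ℕₚ.≤-<-trans (inversions≤n*n σ) n*n<k)) (permutations n)))

infix 4 _=O_

-- f(n) = O(g(n)) as n → ∞.
_=O_ : (ℕ → ℚ) → (ℕ → ℚ) → Set
f =O g = ∃[ C ] ∃[ N ] (∀ n → N ℕ.≤ n → ∣ f n ∣ ≤ C * ∣ g n ∣)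

{-# OPTIONS --safe #-}
module Submission where

-- Deleting the first letter a of a permutation of n + 1 letters and
-- standardising the rest removes exactly a inversions (a counted from 0), so
-- the inversion number X(n+1) is distributed as X(n) + U with U uniform on
-- {0,…,n} and independent of X(n).  Vandermonde's identity for (X(n) + U)_s,
-- cut off after the terms of degree 2 in U, gives
--   β_s(n+1) = β_s(n) + s (n/2) β_{s-1}(n) + C(s,2) (n(n-1)/3) β_{s-2}(n) + O(n^{2s-3}).
-- The claimed main term satisfies the same recurrence up to O(n^{2s-3}), so by
-- induction on s the increments of the difference are O(n^{2s-3}), and
-- summation over n yields O(n^{2s-2}).

open import Defs
open import Data.Nat.Base as ℕ using (ℕ; zero; suc; _^_; _∸_; _!; z≤n; s≤s; z<s; s≤s⁻¹)
open import Data.Nat.Properties using (m^n≢0; m*n≢0)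
import Data.Nat.Properties as ℕₚ
import Data.Nat.Solver as ℕSolver
import Data.Nat.Combinatorics as ℕ
open import Data.Nat.Combinatorics.Base using (_P′_)
open import Data.Integer.Base as ℤ using (ℤ; +_)
import Data.Integer.Properties as ℤₚ
open import Data.Integer.Solver using (module +-*-Solver)
open import Data.Rational.Base
  using (ℚ; mkℚ; 0ℚ; 1ℚ; ½; _/_; _+_; _*_; _-_; -_; _≤_; ∣_∣; ↥_; toℚᵘ; NonNegative; nonNegative)
import Data.Rational.Properties as ℚₚ
import Data.Rational.Solver as ℚSolver
import Data.Rational.Unnormalised.Base as ℚᵘ
import Data.Rational.Unnormalised.Properties as ℚᵘₚ
open import Data.Fin.Base using (Fin; zero; suc; toℕ; punchIn)
import Data.Fin.Properties as Finₚ
open import Data.List.Base as List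
  using (List; []; _∷_; _++_; length; filter; map; upTo; allFin; tabulate; cartesianProduct; cartesianProductWith)
import Data.List.Properties as List
open import Data.List.Relation.Unary.All as All using (All; []; _∷_)
import Data.List.Relation.Unary.All.Properties as All
open import Data.Vec.Base as Vec using (Vec; []; _∷_; lookup)
import Data.Vec.Properties as Vec
open import Data.Vec.Relation.Unary.All as VecAll using ([]; _∷_)
import Data.Vec.Relation.Unary.All.Properties as VecAll
open import Data.Vec.Relation.Unary.AllPairs as AllPairs using ([]; _∷_)
open import Data.Vec.Relation.Unary.Unique.Propositional using (Unique)
import Data.Vec.Relation.Unary.Unique.Propositional.Properties as Unique
open import Data.Bool.Base using (true; false; if_then_else_; T)
open import Data.Product.Base as Product using (∃-syntax; _×_; _,_; proj₁; proj₂)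
open import Data.Sum.Base using (inj₁; inj₂)
open import Function.Base using (_∘_; id)
open import Level using (Level)
open import Relation.Nullary.Decidable using (does; yes; no; ¬?; dec-true; dec-false)
open import Relation.Nullary.Negation using (¬_; contradiction)
open import Relation.Unary using (Pred; Decidable; _≐_; _∩_)
open import Relation.Binary.PropositionalEquality
  using (_≡_; _≢_; refl; sym; trans; cong; cong₂; subst; module ≡-Reasoning)

-- X(n) has size n² and U has size n, so each factor taken from U instead of X costs one power of n:
-- the terms of degree i in U contribute O(n^{2s-i}). Since increments are wanted only up to
-- O(n^{2s-3}), degree 2 is the last that matters. The same count tells how precisely the earlier
-- moments must be known. The term with β_{s-1} carries one factor n and needs both main terms of
-- β_{s-1}; the term with β_{s-2} carries n² and needs only the leading one. The induction therefore
-- runs on two error terms, `residual` and the coarser `weakResidual`. On the combinatorial side,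
-- the list of permutations of n + 1 letters equals, in the same order, the list of all insertions
-- of a first letter. Expectations are then plain normalised sums over lists, and independence of U
-- and X(n) is the product shape of that list.

private variable
  A B C D : Set
  ℓ₁ ℓ₂ ℓ₃ : Level

-- Counting in filtered lists and vectors

module _ {P : Pred B ℓ₁} (P? : Decidable P) where

  filter-map : (f : A → B) (xs : List A) →
    filter P? (map f xs) ≡ map f (filter (P? ∘ f) xs)
  filter-map f []       = refl
  filter-map f (x ∷ xs) with does (P? (f x))
  ... | true  = cong (f x ∷_) (filter-map f xs)
  ... | false = filter-map f xs

  length-filter-map : {Q : Pred A ℓ₂} (Q? : Decidable Q) (f : A → B) → (P ∘ f) ≐ Q →
    ∀ xs → length (filter P? (map f xs)) ≡ length (filter Q? xs)
  length-filter-map Q? f P∘f≐Q xs = begin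
    length (filter P? (map f xs))         ≡⟨ cong length (filter-map f xs) ⟩
    length (map f (filter (P? ∘ f) xs))   ≡⟨ List.length-map f (filter (P? ∘ f) xs) ⟩
    length (filter (P? ∘ f) xs)           ≡⟨ cong length (List.filter-≐ (P? ∘ f) Q? P∘f≐Q xs) ⟩
    length (filter Q? xs)                 ∎
    where open ≡-Reasoning

  length-filter-++ : ∀ xs ys →
    length (filter P? (xs ++ ys)) ≡ length (filter P? xs) ℕ.+ length (filter P? ys)
  length-filter-++ xs ys =
    trans (cong length (List.filter-++ P? xs ys)) (List.length-++ (filter P? xs))

  count-map : {Q : Pred A ℓ₂} (Q? : Decidable Q) (f : A → B) → (P ∘ f) ≐ Q →
    ∀ {n} (xs : Vec A n) → Vec.count P? (Vec.map f xs) ≡ Vec.count Q? xs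
  count-map Q? f P∘f≐Q []       = refl
  count-map Q? f P∘f≐Q (x ∷ xs) with P? (f x) | Q? x
  ... | yes _ | yes _ = cong suc (count-map Q? f P∘f≐Q xs)
  ... | no _  | no _  = count-map Q? f P∘f≐Q xs
  ... | yes p | no ¬q = contradiction (proj₁ P∘f≐Q p) ¬q
  ... | no ¬p | yes q = contradiction (proj₂ P∘f≐Q q) ¬p

  count-accept : ∀ {n x} {xs : Vec B n} → P x → Vec.count P? (x ∷ xs) ≡ suc (Vec.count P? xs)
  count-accept {x = x} px with P? x
  ... | yes _  = refl
  ... | no ¬px = contradiction px ¬px

  count-reject : ∀ {n x} {xs : Vec B n} → ¬ P x → Vec.count P? (x ∷ xs) ≡ Vec.count P? xs
  count-reject {x = x} ¬px with P? x
  ... | yes px = contradiction px ¬px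
  ... | no _   = refl

  -- Passes from counting positions, as `inversions` does, to counting entries, as `#below` does.
  length-filter-lookup : ∀ {n} (xs : Vec B n) →
    length (filter (P? ∘ lookup xs) (allFin n)) ≡ Vec.count P? xs
  length-filter-lookup         []       = refl
  length-filter-lookup {suc n} (x ∷ xs) = begin
    length (filter (P? ∘ lookup (x ∷ xs)) (zero ∷ tabulate suc))
      ≡⟨ step ⟩
    (if does (P? x) then suc else id) (length (filter (P? ∘ lookup (x ∷ xs)) (tabulate suc)))
      ≡⟨ cong (λ is → (if does (P? x) then suc else id) (length (filter (P? ∘ lookup (x ∷ xs)) is)))
           (sym (List.map-tabulate id suc)) ⟩
    (if does (P? x) then suc else id) (length (filter (P? ∘ lookup (x ∷ xs)) (map suc (allFin n))))
      ≡⟨ cong (if does (P? x) then suc else id)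
           (trans (tail-count (allFin n)) (length-filter-lookup xs)) ⟩
    (if does (P? x) then suc else id) (Vec.count P? xs)
      ∎
    where
    open ≡-Reasoning
    step : length (filter (P? ∘ lookup (x ∷ xs)) (zero ∷ tabulate suc)) ≡
      (if does (P? x) then suc else id) (length (filter (P? ∘ lookup (x ∷ xs)) (tabulate suc)))
    step with does (P? x)
    ... | true  = refl
    ... | false = refl
    tail-count : ∀ is → length (filter (P? ∘ lookup (x ∷ xs)) (map suc is)) ≡
      length (filter (P? ∘ lookup xs) is)
    tail-count []       = refl
    tail-count (i ∷ is) with does (P? (lookup xs i))
    ... | true  = cong suc (tail-count is)
    ... | false = tail-count is

filter-∩ : {P : Pred A ℓ₁} {Q : Pred A ℓ₂} {R : Pred A ℓ₃}
  (P? : Decidable P) (Q? : Decidable Q) (R? : Decidable R) → R ≐ (P ∩ Q) →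
  ∀ xs → filter R? xs ≡ filter Q? (filter P? xs)
filter-∩ P? Q? R? R≐P∩Q []       = refl
filter-∩ P? Q? R? R≐P∩Q (x ∷ xs) with R? x | P? x
... | yes r | no ¬p = contradiction (proj₁ (proj₁ R≐P∩Q r)) ¬p
... | no ¬r | no ¬p = filter-∩ P? Q? R? R≐P∩Q xs
... | yes r | yes p = trans (cong (x ∷_) (filter-∩ P? Q? R? R≐P∩Q xs))
                            (sym (List.filter-accept Q? (proj₂ (proj₁ R≐P∩Q r))))
... | no ¬r | yes p = trans (filter-∩ P? Q? R? R≐P∩Q xs)
                            (sym (List.filter-reject Q? (λ q → ¬r (proj₂ R≐P∩Q (p , q)))))

module _ {P : Pred A ℓ₁} {Q : Pred B ℓ₂} {R : Pred C ℓ₃}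
         (P? : Decidable P) (Q? : Decidable Q) (R? : Decidable R)
         (f : A → B → C) (R≐P×Q : ∀ {x y} → (R (f x y) → P x × Q y) × (P x × Q y → R (f x y))) where

  filter-cartesianProductWith : ∀ xs ys →
    filter R? (cartesianProductWith f xs ys) ≡ cartesianProductWith f (filter P? xs) (filter Q? ys)
  filter-cartesianProductWith []       ys = refl
  filter-cartesianProductWith (x ∷ xs) ys
    rewrite List.filter-++ R? (map (f x) ys) (cartesianProductWith f xs ys)
          | filter-cartesianProductWith xs ys
    with P? x
  ... | yes p = cong (_++ cartesianProductWith f (filter P? xs) (filter Q? ys))
                  (trans (filter-map R? (f x) ys)
                         (cong (map (f x)) (List.filter-≐ (R? ∘ f x) Q?
                           (proj₂ ∘ proj₁ R≐P×Q , λ q → proj₂ R≐P×Q (p , q)) ys)))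
  ... | no ¬p = cong (_++ cartesianProductWith f (filter P? xs) (filter Q? ys))
                  (List.filter-none R?
                    (All.map⁺ (All.universal (λ y r → ¬p (proj₁ (proj₁ R≐P×Q r))) ys)))

cartesianProductWith-map : {A′ B′ : Set} (f : A′ → B′ → C) (g : A → A′) (h : B → B′)
  (f′ : A → B → D) (k : D → C) → (∀ x y → f (g x) (h y) ≡ k (f′ x y)) → ∀ xs ys →
  cartesianProductWith f (map g xs) (map h ys) ≡ map k (cartesianProductWith f′ xs ys)
cartesianProductWith-map f g h f′ k eq []       ys = refl
cartesianProductWith-map f g h f′ k eq (x ∷ xs) ys = begin
  map (f (g x)) (map h ys) ++ cartesianProductWith f (map g xs) (map h ys)
    ≡⟨ cong₂ _++_ (trans (sym (List.map-∘ ys)) (trans (List.map-cong (eq x) ys) (List.map-∘ ys)))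
                  (cartesianProductWith-map f g h f′ k eq xs ys) ⟩
  map k (map (f′ x) ys) ++ map k (cartesianProductWith f′ xs ys)
    ≡⟨ List.map-++ k (map (f′ x) ys) _ ⟨
  map k (map (f′ x) ys ++ cartesianProductWith f′ xs ys)
    ∎
  where open ≡-Reasoning

-- Permutations listed by their first letter

allFin-suc : ∀ n → allFin (suc n) ≡ zero ∷ map suc (allFin n)
allFin-suc n = cong (zero ∷_) (sym (List.map-tabulate id suc))

-- `punchIn a` is increasing and its image is everything but `a`, so the lists agree in order as
-- well. This is why `permutations-suc` can be an equation of lists, with no appeal to reordering.
filter-≢-allFin : ∀ {n} (a : Fin (suc n)) →
  filter (λ x → ¬? (a Finₚ.≟ x)) (allFin (suc n)) ≡ map (punchIn a) (allFin n)
filter-≢-allFin {n} zero = begin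
  filter (λ x → ¬? (zero Finₚ.≟ x)) (allFin (suc n))
    ≡⟨ cong (filter (λ x → ¬? (zero Finₚ.≟ x))) (allFin-suc n) ⟩
  filter (λ x → ¬? (zero Finₚ.≟ x)) (map suc (allFin n))
    ≡⟨ List.filter-all (λ x → ¬? (zero Finₚ.≟ x)) (All.map⁺ (All.universal (λ _ ()) (allFin n))) ⟩
  map suc (allFin n)
    ∎
  where open ≡-Reasoning
filter-≢-allFin {suc n} (suc a) = begin
  filter a≢? (allFin (2 ℕ.+ n))
    ≡⟨ cong (filter a≢?) (allFin-suc (suc n)) ⟩
  zero ∷ filter a≢? (map suc (allFin (suc n)))
    ≡⟨ cong (zero ∷_) (filter-map a≢? suc (allFin (suc n))) ⟩
  zero ∷ map suc (filter (a≢? ∘ suc) (allFin (suc n)))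
    ≡⟨ cong (λ xs → zero ∷ map suc xs) (List.filter-≐ (a≢? ∘ suc) (λ x → ¬? (a Finₚ.≟ x))
         ((λ ≢ → ≢ ∘ cong suc) , (λ ≢ → ≢ ∘ Finₚ.suc-injective)) (allFin (suc n))) ⟩
  zero ∷ map suc (filter (λ x → ¬? (a Finₚ.≟ x)) (allFin (suc n)))
    ≡⟨ cong (λ xs → zero ∷ map suc xs) (filter-≢-allFin a) ⟩
  zero ∷ map suc (map (punchIn a) (allFin n))
    ≡⟨ cong (zero ∷_) (trans (sym (List.map-∘ (allFin n))) (List.map-∘ (allFin n))) ⟩
  zero ∷ map (punchIn (suc a)) (map suc (allFin n))
    ≡⟨ cong (map (punchIn (suc a))) (allFin-suc n) ⟨
  map (punchIn (suc a)) (allFin (suc n))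
    ∎
  where
  open ≡-Reasoning
  a≢? : Decidable (suc a ≢_)
  a≢? x = ¬? (suc a Finₚ.≟ x)

filter-avoiding-words : ∀ {n} m (a : Fin (suc n)) →
  filter (VecAll.all? (λ x → ¬? (a Finₚ.≟ x))) (words (suc n) m) ≡ map (Vec.map (punchIn a)) (words n m)
filter-avoiding-words         zero    a = refl
filter-avoiding-words {n = n} (suc m) a = begin
  filter (VecAll.all? a≢?) (cartesianProductWith _∷_ (allFin (suc n)) (words (suc n) m))
    ≡⟨ filter-cartesianProductWith a≢? (VecAll.all? a≢?) (VecAll.all? a≢?) _∷_
         (VecAll.uncons , λ (p , ps) → p ∷ ps) (allFin (suc n)) (words (suc n) m) ⟩
  cartesianProductWith _∷_ (filter a≢? (allFin (suc n))) (filter (VecAll.all? a≢?) (words (suc n) m))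
    ≡⟨ cong₂ (cartesianProductWith _∷_) (filter-≢-allFin a) (filter-avoiding-words m a) ⟩
  cartesianProductWith _∷_ (map (punchIn a) (allFin n)) (map (Vec.map (punchIn a)) (words n m))
    ≡⟨ cartesianProductWith-map _∷_ (punchIn a) (Vec.map (punchIn a)) _∷_ (Vec.map (punchIn a))
         (λ _ _ → refl) (allFin n) (words n m) ⟩
  map (Vec.map (punchIn a)) (words n (suc m))
    ∎
  where
  open ≡-Reasoning
  a≢? : Decidable (a ≢_)
  a≢? x = ¬? (a Finₚ.≟ x)

insert : ∀ {n m} → Fin (suc n) → Vec (Fin n) m → Vec (Fin (suc n)) (suc m)
insert a w = a ∷ Vec.map (punchIn a) w

unique-map-punchIn : ∀ {n m} (a : Fin (suc n)) →
  (λ (w : Vec (Fin n) m) → Unique (Vec.map (punchIn a) w)) ≐ Unique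
unique-map-punchIn a = from _ , Unique.map⁺ (Finₚ.punchIn-injective a _ _)
  where
  from : ∀ {m} (w : Vec _ m) → Unique (Vec.map (punchIn a) w) → Unique w
  from []      []        = []
  from (x ∷ w) (px ∷ ps) = VecAll.map (λ ≢ → ≢ ∘ cong (punchIn a)) (VecAll.map⁻ px) ∷ from w ps

-- `a ∷ w` has no repetition exactly when `w` avoids `a` and has none itself. The words avoiding `a`
-- are the images under `punchIn a`, whose injectivity carries uniqueness back and forth.
filter-unique-∷ : ∀ {n} (a : Fin (suc n)) →
  filter unique? (map (a ∷_) (words (suc n) n)) ≡ map (insert a) (permutations n)
filter-unique-∷ {n} a = begin
  filter unique? (map (a ∷_) (words (suc n) n))
    ≡⟨ filter-map unique? (a ∷_) (words (suc n) n) ⟩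
  map (a ∷_) (filter (unique? ∘ (a ∷_)) (words (suc n) n))
    ≡⟨ cong (map (a ∷_)) (filter-∩ avoids? unique? (unique? ∘ (a ∷_))
         (AllPairs.uncons , λ (p , ps) → p ∷ ps) (words (suc n) n)) ⟩
  map (a ∷_) (filter unique? (filter avoids? (words (suc n) n)))
    ≡⟨ cong (map (a ∷_) ∘ filter unique?) (filter-avoiding-words n a) ⟩
  map (a ∷_) (filter unique? (map (Vec.map (punchIn a)) (words n n)))
    ≡⟨ cong (map (a ∷_)) (filter-map unique? (Vec.map (punchIn a)) (words n n)) ⟩
  map (a ∷_) (map (Vec.map (punchIn a)) (filter (unique? ∘ Vec.map (punchIn a)) (words n n)))
    ≡⟨ List.map-∘ (filter (unique? ∘ Vec.map (punchIn a)) (words n n)) ⟨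
  map (insert a) (filter (unique? ∘ Vec.map (punchIn a)) (words n n))
    ≡⟨ cong (map (insert a)) (List.filter-≐ (unique? ∘ Vec.map (punchIn a)) unique?
         (unique-map-punchIn a) (words n n)) ⟩
  map (insert a) (permutations n)
    ∎
  where
  open ≡-Reasoning
  avoids? : Decidable (VecAll.All (a ≢_))
  avoids? = VecAll.all? (λ x → ¬? (a Finₚ.≟ x))

permutations-suc : ∀ n →
  permutations (suc n) ≡ cartesianProductWith insert (allFin (suc n)) (permutations n)
permutations-suc n = go (allFin (suc n))
  where
  go : ∀ as → filter unique? (cartesianProductWith _∷_ as (words (suc n) n)) ≡
              cartesianProductWith insert as (permutations n)
  go []       = refl
  go (a ∷ as) = trans (List.filter-++ unique? (map (a ∷_) (words (suc n) n)) _)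
                      (cong₂ _++_ (filter-unique-∷ a) (go as))

-- Inversions created by the first letter

below? : ∀ {k} t → Decidable (λ (x : Fin k) → toℕ x ℕ.< t)
below? t x = toℕ x ℕₚ.<? t

#below : ∀ {k m} → ℕ → Vec (Fin k) m → ℕ
#below t = Vec.count (below? t)

-- `punchIn a` fixes the values below `a` and raises the others by one; thresholds up to `a` are
-- therefore unaffected, and those beyond it shift by one in `punchIn-<-high`.
punchIn-<-low : ∀ {n t} (a : Fin (suc n)) → t ℕ.≤ toℕ a →
  (λ x → toℕ (punchIn a x) ℕ.< t) ≐ (λ x → toℕ x ℕ.< t)
punchIn-<-low a t≤a = to a t≤a _ , from a t≤a _
  where
  to : ∀ {n t} (a : Fin (suc n)) → t ℕ.≤ toℕ a → ∀ x → toℕ (punchIn a x) ℕ.< t → toℕ x ℕ.< t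
  to zero    z≤n       x       ()
  to (suc a) t≤a       zero    0<t     = 0<t
  to (suc a) (s≤s t≤a) (suc x) (s≤s <t) = s≤s (to a t≤a x <t)
  from : ∀ {n t} (a : Fin (suc n)) → t ℕ.≤ toℕ a → ∀ x → toℕ x ℕ.< t → toℕ (punchIn a x) ℕ.< t
  from zero    z≤n       x       ()
  from (suc a) t≤a       zero    0<t     = 0<t
  from (suc a) (s≤s t≤a) (suc x) (s≤s <t) = s≤s (from a t≤a x <t)

punchIn-<-high : ∀ {n t} (a : Fin (suc n)) → toℕ a ℕ.≤ t →
  (λ x → toℕ (punchIn a x) ℕ.< suc t) ≐ (λ x → toℕ x ℕ.< t)
punchIn-<-high a a≤t = to a a≤t _ , from a a≤t _
  where
  to : ∀ {n t} (a : Fin (suc n)) → toℕ a ℕ.≤ t → ∀ x → toℕ (punchIn a x) ℕ.< suc t → toℕ x ℕ.< t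
  to zero    a≤t       x       <t       = s≤s⁻¹ <t
  to (suc a) (s≤s a≤t) zero    <t       = z<s
  to (suc a) (s≤s a≤t) (suc x) (s≤s <t) = s≤s (to a a≤t x <t)
  from : ∀ {n t} (a : Fin (suc n)) → toℕ a ℕ.≤ t → ∀ x → toℕ x ℕ.< t → toℕ (punchIn a x) ℕ.< suc t
  from zero    a≤t       x       <t       = s≤s <t
  from (suc a) (s≤s a≤t) zero    <t       = z<s
  from (suc a) (s≤s a≤t) (suc x) (s≤s <t) = s≤s (from a a≤t x <t)

All-cartesianProductWith⁺ : {P : Pred C ℓ₁} {Q : Pred B ℓ₂} (f : A → B → C) →
  (∀ x {y} → Q y → P (f x y)) → ∀ xs {ys} → All Q ys → All P (cartesianProductWith f xs ys)
All-cartesianProductWith⁺ f pres []       qs = []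
All-cartesianProductWith⁺ f pres (x ∷ xs) qs =
  All.++⁺ (All.map⁺ (All.map (pres x) qs)) (All-cartesianProductWith⁺ f pres xs qs)

-- If `a` lies below `t`, the head counts once and the tail is measured with threshold t - 1;
-- otherwise the head does not count and the threshold stays. Both give `t`.
#below-insert : ∀ {n m t} (a : Fin (suc n)) (w : Vec (Fin n) m) → t ℕ.≤ suc n →
  (∀ u → u ℕ.≤ n → #below u w ≡ u) → #below t (insert a w) ≡ t
#below-insert {t = t} a w t≤1+n below with ℕₚ.<-≤-connex (toℕ a) t
#below-insert {t = suc t} a w (s≤s t≤n) below | inj₁ (s≤s a≤t) =
  trans (count-accept (below? (suc t)) {x = a} {Vec.map (punchIn a) w} (s≤s a≤t))
        (cong suc (trans (count-map (below? (suc t)) (below? t) (punchIn a) (punchIn-<-high a a≤t) w) (below t t≤n)))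
... | inj₂ t≤a =
  trans (count-reject (below? t) {x = a} {Vec.map (punchIn a) w} (ℕₚ.≤⇒≯ t≤a))
        (trans (count-map (below? t) (below? t) (punchIn a) (punchIn-<-low a t≤a) w)
               -- Here t ≤ a ≤ n, which sharpens the given t ≤ n + 1 enough for the hypothesis on
               -- `w`.
               (below t (ℕₚ.≤-trans t≤a (Finₚ.toℕ≤pred[n] a))))

-- Every value below `t` occurs exactly once. Induction along `permutations-suc` yields this without
-- a pigeonhole argument, and it makes the first letter `a` responsible for exactly `a` inversions.
#below-permutations : ∀ n → All (λ σ → ∀ t → t ℕ.≤ n → #below t σ ≡ t) (permutations n)
#below-permutations zero    = (λ { zero z≤n → refl }) ∷ []
#below-permutations (suc n) = subst (All _) (sym (permutations-suc n))
  (All-cartesianProductWith⁺ insert (λ a {w} below t t≤1+n → #below-insert a w t≤1+n below)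
    (allFin (suc n)) (#below-permutations n))

-- `punchIn a` preserves and reflects ≤; the strict comparisons follow by contraposition.
inversion-suc : ∀ {n} (a : Fin (suc n)) (w : Vec (Fin n) n) →
  (λ (i , j) → Inversion (insert a w) (suc i , suc j)) ≐ Inversion w
inversion-suc a w = to _ , from _
  where
  to : ∀ ij → Inversion (insert a w) (suc (proj₁ ij) , suc (proj₂ ij)) → Inversion w ij
  to (i , j) (s≤s i<j , σj<σi)
    rewrite Vec.lookup-map i (punchIn a) w | Vec.lookup-map j (punchIn a) w =
    i<j , ℕₚ.≰⇒> (ℕₚ.<⇒≱ σj<σi ∘ Finₚ.punchIn-mono-≤ a (lookup w i) (lookup w j))
  from : ∀ ij → Inversion w ij → Inversion (insert a w) (suc (proj₁ ij) , suc (proj₂ ij))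
  from (i , j) (i<j , wj<wi)
    rewrite Vec.lookup-map i (punchIn a) w | Vec.lookup-map j (punchIn a) w =
    s≤s i<j , ℕₚ.≰⇒> (ℕₚ.<⇒≱ wj<wi ∘ Finₚ.punchIn-cancel-≤ a (lookup w i) (lookup w j))

inversion-zero : ∀ {n} (a : Fin (suc n)) (w : Vec (Fin n) n) →
  (λ j → Inversion (insert a w) (zero , suc j)) ≐ (λ j → toℕ (lookup w j) ℕ.< toℕ a)
inversion-zero a w = to _ , from _
  where
  to : ∀ j → Inversion (insert a w) (zero , suc j) → toℕ (lookup w j) ℕ.< toℕ a
  to j (_ , σj<a) rewrite Vec.lookup-map j (punchIn a) w =
    proj₁ (punchIn-<-low a ℕₚ.≤-refl) σj<a
  from : ∀ j → toℕ (lookup w j) ℕ.< toℕ a → Inversion (insert a w) (zero , suc j)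
  from j wj<a rewrite Vec.lookup-map j (punchIn a) w =
    z<s , proj₂ (punchIn-<-low a ℕₚ.≤-refl) wj<a

-- Pairs that start at the first position see the entries smaller than `a`; pairs of later positions
-- reproduce the inversions of `w`.
inversions-insert : ∀ {n} (a : Fin (suc n)) (w : Vec (Fin n) n) →
  inversions (insert a w) ≡ #below (toℕ a) w ℕ.+ inversions w
inversions-insert {n} a w = begin
  length (filter inv? (cartesianProduct (allFin (suc n)) (allFin (suc n))))
    ≡⟨ cong (λ is → length (filter inv? (cartesianProduct is is))) (allFin-suc n) ⟩
  length (filter inv? (cartesianProduct (zero ∷ is) (zero ∷ is)))
    -- `(zero , zero)` fails i < j, so the filter drops it by computation; the same happens to
    -- `(suc j , zero)` in `other-rows`.
    ≡⟨ length-filter-++ inv? (map (zero ,_) is) _ ⟩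
  length (filter inv? (map (zero ,_) is)) ℕ.+ length (filter inv? (cartesianProduct is (zero ∷ is)))
    ≡⟨ cong₂ ℕ._+_ first-row (other-rows (allFin n)) ⟩
  #below (toℕ a) w ℕ.+ inversions w
    ∎
  where
  open ≡-Reasoning
  inv? = inversion? (insert a w)
  is = map suc (allFin n)
  first-row : length (filter inv? (map (zero ,_) is)) ≡ #below (toℕ a) w
  first-row = begin
    length (filter inv? (map (zero ,_) is))
      ≡⟨ cong (length ∘ filter inv?) (List.map-∘ (allFin n)) ⟨
    length (filter inv? (map (λ j → zero , suc j) (allFin n)))
      ≡⟨ length-filter-map inv? (below? (toℕ a) ∘ lookup w) (λ j → zero , suc j)
           (inversion-zero a w) (allFin n) ⟩
    length (filter (below? (toℕ a) ∘ lookup w) (allFin n))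
      ≡⟨ length-filter-lookup (below? (toℕ a)) w ⟩
    #below (toℕ a) w
      ∎
  other-rows : ∀ js → length (filter inv? (cartesianProduct (map suc js) (zero ∷ is))) ≡
                      length (filter (inversion? w) (cartesianProduct js (allFin n)))
  other-rows []       = refl
  other-rows (j ∷ js) = begin
    length (filter inv? (map (suc j ,_) is ++ cartesianProduct (map suc js) (zero ∷ is)))
      ≡⟨ length-filter-++ inv? (map (suc j ,_) is) _ ⟩
    length (filter inv? (map (suc j ,_) is)) ℕ.+ length (filter inv? (cartesianProduct (map suc js) (zero ∷ is)))
      ≡⟨ cong₂ ℕ._+_ row (other-rows js) ⟩
    length (filter (inversion? w) (map (j ,_) (allFin n))) ℕ.+
      length (filter (inversion? w) (cartesianProduct js (allFin n)))
      ≡⟨ length-filter-++ (inversion? w) (map (j ,_) (allFin n)) _ ⟨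
    length (filter (inversion? w) (cartesianProduct (j ∷ js) (allFin n)))
      ∎
    where
    row : length (filter inv? (map (suc j ,_) is)) ≡ length (filter (inversion? w) (map (j ,_) (allFin n)))
    row = begin
      length (filter inv? (map (suc j ,_) is))
        ≡⟨ cong (length ∘ filter inv?) (trans (sym (List.map-∘ (allFin n))) (List.map-∘ (allFin n))) ⟩
      length (filter inv? (map (Product.map suc suc) (map (j ,_) (allFin n))))
        ≡⟨ length-filter-map inv? (inversion? w) (Product.map suc suc) (inversion-suc a w)
             (map (j ,_) (allFin n)) ⟩
      length (filter (inversion? w) (map (j ,_) (allFin n)))
        ∎

allFin-upTo : ∀ n → map toℕ (allFin n) ≡ upTo n
allFin-upTo n = trans (List.map-tabulate id toℕ) (go n id)
  where
  go : {A : Set} (n : ℕ) (f : ℕ → A) → tabulate {n = n} (f ∘ toℕ) ≡ List.applyUpTo f n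
  go zero    f = refl
  go (suc n) f = cong (f 0 ∷_) (go n (f ∘ suc))

-- Integers and unit fractions inside the rationals

fromℤ : ℤ → ℚ
fromℤ i = i / 1

toℚᵘ-fromℤ : ∀ i → toℚᵘ (fromℤ i) ℚᵘ.≃ ℚᵘ.mkℚᵘ i 0
toℚᵘ-fromℤ i = ℚₚ.toℚᵘ-fromℚᵘ (ℚᵘ.mkℚᵘ i 0)

-- For unnormalised fractions the claim is a cross-multiplied identity of integers, free of any gcd.
fromℤ-+ : ∀ i j → fromℤ (i ℤ.+ j) ≡ fromℤ i + fromℤ j
fromℤ-+ i j = ℚₚ.toℚᵘ-injective (begin
  toℚᵘ (fromℤ (i ℤ.+ j))                 ≈⟨ toℚᵘ-fromℤ (i ℤ.+ j) ⟩
  ℚᵘ.mkℚᵘ (i ℤ.+ j) 0                    ≈⟨ ℚᵘ.*≡* (solve 2 (λ i j → (i :+ j) :* con (+ 1)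
                                               := (i :* con (+ 1) :+ j :* con (+ 1)) :* con (+ 1)) refl i j) ⟩
  ℚᵘ.mkℚᵘ i 0 ℚᵘ.+ ℚᵘ.mkℚᵘ j 0         ≈⟨ ℚᵘₚ.+-cong (toℚᵘ-fromℤ i) (toℚᵘ-fromℤ j) ⟨
  toℚᵘ (fromℤ i) ℚᵘ.+ toℚᵘ (fromℤ j)   ≈⟨ ℚₚ.toℚᵘ-homo-+ (fromℤ i) (fromℤ j) ⟨
  toℚᵘ (fromℤ i + fromℤ j)             ∎)
  where
  open ℚᵘₚ.≃-Reasoning
  open +-*-Solver

fromℤ-* : ∀ i j → fromℤ (i ℤ.* j) ≡ fromℤ i * fromℤ j
fromℤ-* i j = ℚₚ.toℚᵘ-injective (begin
  toℚᵘ (fromℤ (i ℤ.* j))               ≈⟨ toℚᵘ-fromℤ (i ℤ.* j) ⟩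
  ℚᵘ.mkℚᵘ i 0 ℚᵘ.* ℚᵘ.mkℚᵘ j 0         ≈⟨ ℚᵘₚ.*-cong (toℚᵘ-fromℤ i) (toℚᵘ-fromℤ j) ⟨
  toℚᵘ (fromℤ i) ℚᵘ.* toℚᵘ (fromℤ j)   ≈⟨ ℚₚ.toℚᵘ-homo-* (fromℤ i) (fromℤ j) ⟨
  toℚᵘ (fromℤ i * fromℤ j)             ∎)
  where open ℚᵘₚ.≃-Reasoning

open ℚSolver.+-*-Solver

/≡fromℤ*1/ : ∀ i d .{{_ : ℕ.NonZero d}} → i / d ≡ fromℤ i * (+ 1 / d)
/≡fromℤ*1/ i d@(suc d-1) = ℚₚ.toℚᵘ-injective (begin
  toℚᵘ (i / d)                           ≈⟨ ℚₚ.toℚᵘ-fromℚᵘ (ℚᵘ.mkℚᵘ i d-1) ⟩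
  ℚᵘ.mkℚᵘ i d-1                          ≈⟨ ℚᵘ.*≡* (trans (cong (λ m → i ℤ.* + m) (ℕₚ.+-identityʳ d))
                                               (cong (ℤ._* + d) (sym (ℤₚ.*-identityʳ i)))) ⟩
  ℚᵘ.mkℚᵘ i 0 ℚᵘ.* ℚᵘ.mkℚᵘ (+ 1) d-1   ≈⟨ ℚᵘₚ.*-cong (toℚᵘ-fromℤ i) (ℚₚ.toℚᵘ-fromℚᵘ (ℚᵘ.mkℚᵘ (+ 1) d-1)) ⟨
  toℚᵘ (fromℤ i) ℚᵘ.* toℚᵘ (+ 1 / d)   ≈⟨ ℚₚ.toℚᵘ-homo-* (fromℤ i) (+ 1 / d) ⟨
  toℚᵘ (fromℤ i * (+ 1 / d))           ∎)
  where open ℚᵘₚ.≃-Reasoning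

fromℕ-mono-≤ : ∀ {m n} → m ℕ.≤ n → fromℕ m ≤ fromℕ n
fromℕ-mono-≤ {m} {n} m≤n = ℚₚ.toℚᵘ-cancel-≤ (begin
  toℚᵘ (fromℕ m)    ≃⟨ toℚᵘ-fromℤ (+ m) ⟩
  ℚᵘ.mkℚᵘ (+ m) 0   ≤⟨ ℚᵘ.*≤* (ℤₚ.*-monoʳ-≤-nonNeg (+ 1) (ℤ.+≤+ m≤n)) ⟩
  ℚᵘ.mkℚᵘ (+ n) 0   ≃⟨ toℚᵘ-fromℤ (+ n) ⟨
  toℚᵘ (fromℕ n)    ∎)
  where open ℚᵘₚ.≤-Reasoning

-- The denominator is at least 1. Every rational constant thus has a natural bound, so the constants
-- of all O-estimates can be natural numbers.
∣p∣≤∣↥p∣ : ∀ p → ∣ p ∣ ≤ fromℕ ℤ.∣ ↥ p ∣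
∣p∣≤∣↥p∣ (mkℚ i d-1 c) = ℚₚ.toℚᵘ-cancel-≤ {∣ mkℚ i d-1 c ∣} {fromℕ ℤ.∣ i ∣} (begin
  ℚᵘ.mkℚᵘ (+ ℤ.∣ i ∣) d-1   ≤⟨ ℚᵘ.*≤* (ℤₚ.*-monoˡ-≤-nonNeg (+ ℤ.∣ i ∣) (ℤ.+≤+ (s≤s (z≤n {d-1})))) ⟩
  ℚᵘ.mkℚᵘ (+ ℤ.∣ i ∣) 0     ≃⟨ toℚᵘ-fromℤ (+ ℤ.∣ i ∣) ⟨
  toℚᵘ (fromℕ ℤ.∣ i ∣)      ∎)
  where open ℚᵘₚ.≤-Reasoning

-- Opaque copies of fromℕ and of + 1 / d: otherwise unification unfolds the
-- normalisation by gcd hidden in _/_.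
opaque

  ι : ℕ → ℚ
  ι = fromℕ

  inv : ∀ d .{{_ : ℕ.NonZero d}} → ℚ
  inv d = + 1 / d

  fromℕ≡ι : ∀ n → fromℕ n ≡ ι n
  fromℕ≡ι n = refl

  /≡fromℤ*inv : ∀ i d .{{_ : ℕ.NonZero d}} → i / d ≡ fromℤ i * inv d
  /≡fromℤ*inv = /≡fromℤ*1/

  ι-0 : ι 0 ≡ 0ℚ
  ι-0 = refl

  ι-1 : ι 1 ≡ 1ℚ
  ι-1 = refl

  ι-+ : ∀ m n → ι (m ℕ.+ n) ≡ ι m + ι n
  ι-+ m n = fromℤ-+ (+ m) (+ n)

  ι-* : ∀ m n → ι (m ℕ.* n) ≡ ι m * ι n
  ι-* m n = trans (cong fromℤ (ℤₚ.pos-* m n)) (fromℤ-* (+ m) (+ n))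

  ι-mono-≤ : ∀ {m n} → m ℕ.≤ n → ι m ≤ ι n
  ι-mono-≤ {m} {n} = fromℕ-mono-≤ {m} {n}

  ∣p∣≤ι∣↥p∣ : ∀ p → ∣ p ∣ ≤ ι ℤ.∣ ↥ p ∣
  ∣p∣≤ι∣↥p∣ = ∣p∣≤∣↥p∣

  0≤inv : ∀ d .{{_ : ℕ.NonZero d}} → 0ℚ ≤ inv d
  0≤inv d = ℚₚ.nonNegative⁻¹ (+ 1 / d) {{ℚₚ.normalize-nonNeg 1 d}}

  ι-inv : ∀ d .{{_ : ℕ.NonZero d}} → ι d * inv d ≡ 1ℚ
  ι-inv d@(suc d-1) = trans (sym (/≡fromℤ*1/ (+ d) d))
    (ℚₚ.toℚᵘ-injective (ℚᵘₚ.≃-trans (ℚₚ.toℚᵘ-fromℚᵘ (ℚᵘ.mkℚᵘ (+ d) d-1)) (ℚᵘ.*≡* (ℤₚ.*-comm (+ d) (+ 1)))))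

/≡ι*inv : ∀ m d .{{_ : ℕ.NonZero d}} → + m / d ≡ ι m * inv d
/≡ι*inv m d = trans (/≡fromℤ*inv (+ m) d) (cong (_* inv d) (fromℕ≡ι m))

ι-suc : ∀ n → ι (suc n) ≡ 1ℚ + ι n
ι-suc n = trans (ι-+ 1 n) (cong (_+ ι n) ι-1)

ι-∸ : ∀ {m n} → n ℕ.≤ m → ι (m ∸ n) ≡ ι m - ι n
ι-∸ {m} {n} n≤m = begin
  ι (m ∸ n)               ≡⟨ solve 2 (λ x y → x := (x :+ y) :- y) refl (ι (m ∸ n)) (ι n) ⟩
  ι (m ∸ n) + ι n - ι n   ≡⟨ cong (_- ι n) (sym (ι-+ (m ∸ n) n)) ⟩
  ι (m ∸ n ℕ.+ n) - ι n   ≡⟨ cong (λ k → ι k - ι n) (ℕₚ.m∸n+n≡m n≤m) ⟩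
  ι m - ι n               ∎
  where open ≡-Reasoning

inv-* : ∀ m n .{{_ : ℕ.NonZero m}} .{{_ : ℕ.NonZero n}} .{{_ : ℕ.NonZero (m ℕ.* n)}} →
  inv (m ℕ.* n) ≡ inv m * inv n
inv-* m n = begin
  inv (m ℕ.* n)                                              ≡⟨ ℚₚ.*-identityʳ _ ⟨
  inv (m ℕ.* n) * 1ℚ                                         ≡⟨ cong (inv (m ℕ.* n) *_) (cong₂ _*_ (ι-inv m) (ι-inv n)) ⟨
  inv (m ℕ.* n) * ((ι m * inv m) * (ι n * inv n))
    ≡⟨ solve 5 (λ a b c d e → a :* ((b :* c) :* (d :* e)) := ((b :* d) :* a) :* (c :* e)) refl
         (inv (m ℕ.* n)) (ι m) (inv m) (ι n) (inv n) ⟩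
  ((ι m * ι n) * inv (m ℕ.* n)) * (inv m * inv n)
    ≡⟨ cong (λ p → (p * inv (m ℕ.* n)) * (inv m * inv n)) (ι-* m n) ⟨
  (ι (m ℕ.* n) * inv (m ℕ.* n)) * (inv m * inv n)
    ≡⟨ cong (_* (inv m * inv n)) (ι-inv (m ℕ.* n)) ⟩
  1ℚ * (inv m * inv n)                                       ≡⟨ ℚₚ.*-identityˡ _ ⟩
  inv m * inv n                                              ∎
  where open ≡-Reasoning

0≤ι : ∀ n → 0ℚ ≤ ι n
0≤ι n = subst (_≤ ι n) ι-0 (ι-mono-≤ z≤n)

instance
  ι-nonNeg : ∀ {n} → NonNegative (ι n)
  ι-nonNeg {n} = nonNegative (0≤ι n)

∣ι∣ : ∀ n → ∣ ι n ∣ ≡ ι n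
∣ι∣ n = ℚₚ.0≤p⇒∣p∣≡p (0≤ι n)

*-mono-≤-ι : ∀ {p q m n} → ∣ p ∣ ≤ ι m → ∣ q ∣ ≤ ι n → ∣ p * q ∣ ≤ ι (m ℕ.* n)
*-mono-≤-ι {p} {q} {m} {n} p≤m q≤n = begin
  ∣ p * q ∣       ≡⟨ ℚₚ.∣p*q∣≡∣p∣*∣q∣ p q ⟩
  ∣ p ∣ * ∣ q ∣   ≤⟨ ℚₚ.*-monoʳ-≤-nonNeg ∣ q ∣ {{ℚₚ.∣-∣-nonNeg q}} p≤m ⟩
  ι m * ∣ q ∣     ≤⟨ ℚₚ.*-monoˡ-≤-nonNeg (ι m) q≤n ⟩
  ι m * ι n       ≡⟨ ι-* m n ⟨
  ι (m ℕ.* n)     ∎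
  where open ℚₚ.≤-Reasoning

+-mono-≤-ι : ∀ {p q m n} → ∣ p ∣ ≤ ι m → ∣ q ∣ ≤ ι n → ∣ p + q ∣ ≤ ι (m ℕ.+ n)
+-mono-≤-ι {p} {q} {m} {n} p≤m q≤n = begin
  ∣ p + q ∣       ≤⟨ ℚₚ.∣p+q∣≤∣p∣+∣q∣ p q ⟩
  ∣ p ∣ + ∣ q ∣   ≤⟨ ℚₚ.+-mono-≤ p≤m q≤n ⟩
  ι m + ι n       ≡⟨ ι-+ m n ⟨
  ι (m ℕ.+ n)     ∎
  where open ℚₚ.≤-Reasoning

-- Finite sums

∑ : List A → (A → ℚ) → ℚ
∑ xs g = sumℚ (map g xs)

module _ {A : Set} where

  ∑-cong-local : ∀ {f g : A → ℚ} {xs} → All (λ x → f x ≡ g x) xs → ∑ xs f ≡ ∑ xs g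
  ∑-cong-local eqs = cong sumℚ (List.map-cong-local eqs)

  ∑-cong : ∀ {f g : A → ℚ} → (∀ x → f x ≡ g x) → ∀ xs → ∑ xs f ≡ ∑ xs g
  ∑-cong eq xs = cong sumℚ (List.map-cong eq xs)

  ∑-0 : ∀ (xs : List A) → ∑ xs (λ _ → 0ℚ) ≡ 0ℚ
  ∑-0 []       = refl
  ∑-0 (x ∷ xs) = trans (ℚₚ.+-identityˡ _) (∑-0 xs)

  ∑-+ : ∀ (f g : A → ℚ) xs → ∑ xs (λ x → f x + g x) ≡ ∑ xs f + ∑ xs g
  ∑-+ f g []       = refl
  ∑-+ f g (x ∷ xs) = trans (cong (_+_ (f x + g x)) (∑-+ f g xs))
    (solve 4 (λ a b c d → (a :+ b) :+ (c :+ d) := (a :+ c) :+ (b :+ d)) refl (f x) (g x) (∑ xs f) (∑ xs g))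

  ∑-*ˡ : ∀ c (f : A → ℚ) xs → ∑ xs (λ x → c * f x) ≡ c * ∑ xs f
  ∑-*ˡ c f []       = sym (ℚₚ.*-zeroʳ c)
  ∑-*ˡ c f (x ∷ xs) = trans (cong (_+_ (c * f x)) (∑-*ˡ c f xs)) (sym (ℚₚ.*-distribˡ-+ c (f x) (∑ xs f)))

  ∑-*ʳ : ∀ c (f : A → ℚ) xs → ∑ xs (λ x → f x * c) ≡ ∑ xs f * c
  ∑-*ʳ c f xs = trans (∑-cong (λ x → ℚₚ.*-comm (f x) c) xs) (trans (∑-*ˡ c f xs) (ℚₚ.*-comm c _))

  ∑-++ : ∀ (f : A → ℚ) xs ys → ∑ (xs ++ ys) f ≡ ∑ xs f + ∑ ys f
  ∑-++ f []       ys = sym (ℚₚ.+-identityˡ _)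
  ∑-++ f (x ∷ xs) ys = trans (cong (_+_ (f x)) (∑-++ f xs ys)) (sym (ℚₚ.+-assoc (f x) _ _))

  ∑-bound : ∀ {f : A → ℚ} {B xs} → All (λ x → ∣ f x ∣ ≤ B) xs → ∣ ∑ xs f ∣ ≤ ι (length xs) * B
  ∑-bound {B = B} [] = ℚₚ.≤-reflexive (sym (trans (cong (_* B) ι-0) (ℚₚ.*-zeroˡ B)))
  ∑-bound {f} {B} {x ∷ xs} (fx≤B ∷ fxs≤B) = begin
    ∣ f x + ∑ xs f ∣           ≤⟨ ℚₚ.∣p+q∣≤∣p∣+∣q∣ (f x) _ ⟩
    ∣ f x ∣ + ∣ ∑ xs f ∣       ≤⟨ ℚₚ.+-mono-≤ fx≤B (∑-bound fxs≤B) ⟩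
    B + ι (length xs) * B      ≡⟨ solve 2 (λ b l → b :+ l :* b := (con 1ℚ :+ l) :* b) refl B (ι (length xs)) ⟩
    (1ℚ + ι (length xs)) * B   ≡⟨ cong (_* B) (ι-suc (length xs)) ⟨
    ι (suc (length xs)) * B    ∎
    where open ℚₚ.≤-Reasoning

∑-map : (f : A → B) (g : B → ℚ) → ∀ xs → ∑ (map f xs) g ≡ ∑ xs (g ∘ f)
∑-map f g xs = cong sumℚ (sym (List.map-∘ xs))

∑-cartesianProductWith : (f : A → B → C) (g : C → ℚ) → ∀ xs ys →
  ∑ (cartesianProductWith f xs ys) g ≡ ∑ xs (λ x → ∑ ys (λ y → g (f x y)))
∑-cartesianProductWith f g []       ys = refl
∑-cartesianProductWith f g (x ∷ xs) ys = trans (∑-++ g (map (f x) ys) _)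
  (cong₂ _+_ (∑-map (f x) g ys) (∑-cartesianProductWith f g xs ys))

∑-upTo-suc : ∀ n f → ∑ (upTo (suc n)) f ≡ ∑ (upTo n) f + f n
∑-upTo-suc n f = trans (cong (λ is → ∑ is f) (sym (List.upTo-∷ʳ n)))
  (trans (∑-++ f (upTo n) (n ∷ [])) (cong (_+_ (∑ (upTo n) f)) (ℚₚ.+-identityʳ (f n))))

δ : ℕ → ℕ → ℚ
δ i j = if does (i ℕₚ.≟ j) then 1ℚ else 0ℚ

δ-refl : ∀ i → δ i i ≡ 1ℚ
δ-refl i = cong (if_then 1ℚ else 0ℚ) (dec-true (i ℕₚ.≟ i) refl)

δ-≢ : ∀ {i j} → i ≢ j → δ i j ≡ 0ℚ
δ-≢ {i} {j} i≢j = cong (if_then 1ℚ else 0ℚ) (dec-false (i ℕₚ.≟ j) i≢j)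

∑-δ-≥ : ∀ (f : ℕ → ℚ) {i} N → N ℕ.≤ i → ∑ (upTo N) (λ k → f k * δ i k) ≡ 0ℚ
∑-δ-≥ f     zero    N≤i = refl
∑-δ-≥ f {i} (suc N) N<i = begin
  ∑ (upTo (suc N)) (λ k → f k * δ i k)           ≡⟨ ∑-upTo-suc N (λ k → f k * δ i k) ⟩
  ∑ (upTo N) (λ k → f k * δ i k) + f N * δ i N   ≡⟨ cong₂ _+_ (∑-δ-≥ f N (ℕₚ.<⇒≤ N<i))
                                                     (trans (cong (f N *_) (δ-≢ (ℕₚ.>⇒≢ N<i))) (ℚₚ.*-zeroʳ (f N))) ⟩
  0ℚ                                             ∎
  where open ≡-Reasoning

∑-δ : ∀ (f : ℕ → ℚ) {i N} → i ℕ.< N → ∑ (upTo N) (λ k → f k * δ i k) ≡ f i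
∑-δ f {i} {suc N} (s≤s i≤N) with ℕₚ.m≤n⇒m<n∨m≡n i≤N
... | inj₁ i<N = begin
  ∑ (upTo (suc N)) (λ k → f k * δ i k)           ≡⟨ ∑-upTo-suc N (λ k → f k * δ i k) ⟩
  ∑ (upTo N) (λ k → f k * δ i k) + f N * δ i N   ≡⟨ cong₂ _+_ (∑-δ f i<N)
                                                     (trans (cong (f N *_) (δ-≢ (ℕₚ.<⇒≢ i<N))) (ℚₚ.*-zeroʳ (f N))) ⟩
  f i + 0ℚ                                       ≡⟨ ℚₚ.+-identityʳ (f i) ⟩
  f i                                            ∎
  where open ≡-Reasoning
... | inj₂ refl = begin
  ∑ (upTo (suc N)) (λ k → f k * δ i k)           ≡⟨ ∑-upTo-suc N (λ k → f k * δ i k) ⟩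
  ∑ (upTo N) (λ k → f k * δ i k) + f N * δ i N   ≡⟨ cong₂ _+_ (∑-δ-≥ f N ℕₚ.≤-refl)
                                                     (trans (cong (f N *_) (δ-refl N)) (ℚₚ.*-identityʳ (f N))) ⟩
  0ℚ + f N                                       ≡⟨ ℚₚ.+-identityˡ (f N) ⟩
  f N                                            ∎
  where open ≡-Reasoning

-- Each `x` lies in the single fibre over `h x`, which is below the cut-off `N`, and so contributes
-- `f (h x)` once.
∑-fibres : ∀ (f : ℕ → ℚ) (h : A → ℕ) {N xs} → All (λ x → h x ℕ.< N) xs →
  ∑ (upTo N) (λ k → f k * ι (length (filter (λ x → h x ℕₚ.≟ k) xs))) ≡ ∑ xs (f ∘ h)
∑-fibres f h {N} [] = trans (∑-cong (λ k → trans (cong (f k *_) ι-0) (ℚₚ.*-zeroʳ (f k))) (upTo N)) (∑-0 (upTo N))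
∑-fibres f h {N} {x ∷ xs} (hx<N ∷ hxs<N) = begin
  ∑ (upTo N) (λ k → f k * ι (#fibre k (x ∷ xs)))
    ≡⟨ ∑-cong (λ k → trans (cong (f k *_) (step k)) (ℚₚ.*-distribˡ-+ (f k) _ _)) (upTo N) ⟩
  ∑ (upTo N) (λ k → f k * δ (h x) k + f k * ι (#fibre k xs))
    ≡⟨ ∑-+ (λ k → f k * δ (h x) k) (λ k → f k * ι (#fibre k xs)) (upTo N) ⟩
  ∑ (upTo N) (λ k → f k * δ (h x) k) + ∑ (upTo N) (λ k → f k * ι (#fibre k xs))
    ≡⟨ cong₂ _+_ (∑-δ f hx<N) (∑-fibres f h hxs<N) ⟩
  f (h x) + ∑ xs (f ∘ h)
    ∎
  where
  open ≡-Reasoning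
  #fibre : ℕ → List _ → ℕ
  #fibre k = length ∘ filter (λ x → h x ℕₚ.≟ k)
  step : ∀ k → ι (#fibre k (x ∷ xs)) ≡ δ (h x) k + ι (#fibre k xs)
  step k with does (h x ℕₚ.≟ k)
  ... | true  = ι-suc (#fibre k xs)
  ... | false = sym (ℚₚ.+-identityˡ _)

-- Means over letters and over permutations

inv! : ℕ → ℚ
inv! n = inv (n !) {{n ℕₚ.!≢0}}

inv!-suc : ∀ n → inv! (suc n) ≡ inv (suc n) * inv! n
inv!-suc n = inv-* (suc n) (n !) {{_}} {{n ℕₚ.!≢0}} {{suc n ℕₚ.!≢0}}

inv-1 : inv 1 ≡ 1ℚ
inv-1 = trans (sym (ℚₚ.*-identityˡ (inv 1))) (trans (cong (_* inv 1) (sym ι-1)) (ι-inv 1))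

∑-permutations-suc : ∀ n (g : ℕ → ℚ) →
  ∑ (permutations (suc n)) (g ∘ inversions) ≡
  ∑ (upTo (suc n)) (λ a → ∑ (permutations n) (λ σ → g (a ℕ.+ inversions σ)))
∑-permutations-suc n g = begin
  ∑ (permutations (suc n)) (g ∘ inversions)
    ≡⟨ cong (λ σs → ∑ σs (g ∘ inversions)) (permutations-suc n) ⟩
  ∑ (cartesianProductWith insert (allFin (suc n)) (permutations n)) (g ∘ inversions)
    ≡⟨ ∑-cartesianProductWith insert (g ∘ inversions) (allFin (suc n)) (permutations n) ⟩
  ∑ (allFin (suc n)) (λ a → ∑ (permutations n) (λ σ → g (inversions (insert a σ))))
    -- The count `#below (toℕ a) σ` is `toℕ a` only for permutations, hence a congruence restricted
    -- to the listed `σ`.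
    ≡⟨ ∑-cong (λ a → ∑-cong-local (All.map (λ {σ} → row a σ) (#below-permutations n))) (allFin (suc n)) ⟩
  ∑ (allFin (suc n)) (λ a → ∑ (permutations n) (λ σ → g (toℕ a ℕ.+ inversions σ)))
    ≡⟨ ∑-map toℕ (λ a → ∑ (permutations n) (λ σ → g (a ℕ.+ inversions σ))) (allFin (suc n)) ⟨
  ∑ (map toℕ (allFin (suc n))) (λ a → ∑ (permutations n) (λ σ → g (a ℕ.+ inversions σ)))
    ≡⟨ cong (λ as → ∑ as (λ a → ∑ (permutations n) (λ σ → g (a ℕ.+ inversions σ)))) (allFin-upTo (suc n)) ⟩
  ∑ (upTo (suc n)) (λ a → ∑ (permutations n) (λ σ → g (a ℕ.+ inversions σ)))
    ∎
  where
  open ≡-Reasoning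
  row : ∀ a σ → (∀ t → t ℕ.≤ n → #below t σ ≡ t) →
    g (inversions (insert a σ)) ≡ g (toℕ a ℕ.+ inversions σ)
  row a σ below = cong g (trans (inversions-insert a σ)
    (cong (ℕ._+ inversions σ) (below (toℕ a) (Finₚ.toℕ≤pred[n] a))))

∑-bound-inv : {A : Set} {f : A → ℚ} {B : ℚ} {xs : List A} {d : ℕ} .{{_ : ℕ.NonZero d}} →
  length xs ≡ d → All (λ x → ∣ f x ∣ ≤ B) xs → ∣ ∑ xs f * inv d ∣ ≤ B
∑-bound-inv {f = f} {B} {xs} {d} len f≤B = begin
  ∣ ∑ xs f * inv d ∣          ≡⟨ ℚₚ.∣p*q∣≡∣p∣*∣q∣ (∑ xs f) (inv d) ⟩
  ∣ ∑ xs f ∣ * ∣ inv d ∣      ≡⟨ cong (∣ ∑ xs f ∣ *_) (ℚₚ.0≤p⇒∣p∣≡p (0≤inv d)) ⟩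
  ∣ ∑ xs f ∣ * inv d          ≤⟨ ℚₚ.*-monoʳ-≤-nonNeg (inv d) {{nonNegative (0≤inv d)}} (∑-bound f≤B) ⟩
  ι (length xs) * B * inv d   ≡⟨ cong (λ l → ι l * B * inv d) len ⟩
  ι d * B * inv d             ≡⟨ solve 3 (λ l b i → l :* b :* i := (l :* i) :* b) refl (ι d) B (inv d) ⟩
  ι d * inv d * B             ≡⟨ cong (_* B) (ι-inv d) ⟩
  1ℚ * B                      ≡⟨ ℚₚ.*-identityˡ B ⟩
  B                           ∎
  where open ℚₚ.≤-Reasoning

length-cartesianProductWith : {A B C : Set} (f : A → B → C) (xs : List A) (ys : List B) →
  length (cartesianProductWith f xs ys) ≡ length xs ℕ.* length ys
length-cartesianProductWith f []       ys = refl
length-cartesianProductWith f (x ∷ xs) ys = trans (List.length-++ (map (f x) ys))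
  (cong₂ ℕ._+_ (List.length-map (f x) ys) (length-cartesianProductWith f xs ys))

length-permutations : ∀ n → length (permutations n) ≡ n !
length-permutations zero    = refl
length-permutations (suc n) = begin
  length (permutations (suc n))
    ≡⟨ cong length (permutations-suc n) ⟩
  length (cartesianProductWith insert (allFin (suc n)) (permutations n))
    ≡⟨ length-cartesianProductWith insert (allFin (suc n)) (permutations n) ⟩
  length (allFin (suc n)) ℕ.* length (permutations n)
    ≡⟨ cong₂ ℕ._*_ (List.length-tabulate {n = suc n} id) (length-permutations n) ⟩
  suc n !
    ∎
  where open ≡-Reasoning

opaque

  avg : ℕ → (ℕ → ℚ) → ℚ
  avg n h = ∑ (upTo (suc n)) h * inv (suc n)

  E : ℕ → (ℕ → ℚ) → ℚ
  E n g = ∑ (permutations n) (g ∘ inversions) * inv! n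

  E-0 : ∀ g → E 0 g ≡ g 0
  E-0 g = begin
    (g 0 + 0ℚ) * inv 1   ≡⟨ cong (_* inv 1) (ℚₚ.+-identityʳ (g 0)) ⟩
    g 0 * inv 1          ≡⟨ cong (g 0 *_) inv-1 ⟩
    g 0 * 1ℚ             ≡⟨ ℚₚ.*-identityʳ (g 0) ⟩
    g 0                  ∎
    where open ≡-Reasoning

  E-suc : ∀ n g → E (suc n) g ≡ avg n (λ a → E n (λ k → g (a ℕ.+ k)))
  E-suc n g = begin
    ∑ (permutations (suc n)) (g ∘ inversions) * inv! (suc n)
      ≡⟨ cong₂ _*_ (∑-permutations-suc n g) (inv!-suc n) ⟩
    ∑ (upTo (suc n)) S * (inv (suc n) * inv! n)
      ≡⟨ solve 3 (λ s a b → s :* (a :* b) := (s :* b) :* a) refl (∑ (upTo (suc n)) S) (inv (suc n)) (inv! n) ⟩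
    ∑ (upTo (suc n)) S * inv! n * inv (suc n)
      ≡⟨ cong (_* inv (suc n)) (∑-*ʳ (inv! n) S (upTo (suc n))) ⟨
    avg n (λ a → E n (λ k → g (a ℕ.+ k)))
      ∎
    where
    open ≡-Reasoning
    S : ℕ → ℚ
    S a = ∑ (permutations n) (λ σ → g (a ℕ.+ inversions σ))

  E-cong : ∀ n {f g} → (∀ k → f k ≡ g k) → E n f ≡ E n g
  E-cong n eq = cong (_* inv! n) (∑-cong (eq ∘ inversions) (permutations n))

  E-+ : ∀ n f g → E n (λ k → f k + g k) ≡ E n f + E n g
  E-+ n f g = trans (cong (_* inv! n) (∑-+ (f ∘ inversions) (g ∘ inversions) (permutations n)))
                    (ℚₚ.*-distribʳ-+ (inv! n) (∑ (permutations n) (f ∘ inversions)) (∑ (permutations n) (g ∘ inversions)))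

  E-*ˡ : ∀ n c f → E n (λ k → c * f k) ≡ c * E n f
  E-*ˡ n c f = trans (cong (_* inv! n) (∑-*ˡ c (f ∘ inversions) (permutations n)))
                     (ℚₚ.*-assoc c _ _)

  avg-cong : ∀ n {f g} → (∀ a → f a ≡ g a) → avg n f ≡ avg n g
  avg-cong n eq = cong (_* inv (suc n)) (∑-cong eq (upTo (suc n)))

  avg-+ : ∀ n f g → avg n (λ a → f a + g a) ≡ avg n f + avg n g
  avg-+ n f g = trans (cong (_* inv (suc n)) (∑-+ f g (upTo (suc n))))
                      (ℚₚ.*-distribʳ-+ (inv (suc n)) (∑ (upTo (suc n)) f) (∑ (upTo (suc n)) g))

  avg-*ʳ : ∀ n c f → avg n (λ a → f a * c) ≡ avg n f * c
  avg-*ʳ n c f = trans (cong (_* inv (suc n)) (∑-*ʳ c f (upTo (suc n))))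
    (solve 3 (λ s c i → s :* c :* i := s :* i :* c) refl (∑ (upTo (suc n)) f) c (inv (suc n)))

  -- The closed form s is given as the average, so that s * (n + 1) telescopes.
  avg-closed : ∀ (f s : ℕ → ℚ) → f 0 ≡ s 0 →
    (∀ n → s n * ι (suc n) + f (suc n) ≡ s (suc n) * ι (2 ℕ.+ n)) → ∀ n → avg n f ≡ s n
  avg-closed f s base step n = begin
    ∑ (upTo (suc n)) f * inv (suc n)   ≡⟨ cong (_* inv (suc n)) (total n) ⟩
    s n * ι (suc n) * inv (suc n)      ≡⟨ ℚₚ.*-assoc (s n) _ _ ⟩
    s n * (ι (suc n) * inv (suc n))    ≡⟨ cong (s n *_) (ι-inv (suc n)) ⟩
    s n * 1ℚ                           ≡⟨ ℚₚ.*-identityʳ (s n) ⟩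
    s n                                ∎
    where
    open ≡-Reasoning
    total : ∀ n → ∑ (upTo (suc n)) f ≡ s n * ι (suc n)
    total zero    = begin
      f 0 + 0ℚ    ≡⟨ ℚₚ.+-identityʳ (f 0) ⟩
      f 0         ≡⟨ base ⟩
      s 0         ≡⟨ ℚₚ.*-identityʳ (s 0) ⟨
      s 0 * 1ℚ    ≡⟨ cong (s 0 *_) ι-1 ⟨
      s 0 * ι 1   ∎
    total (suc n) = trans (∑-upTo-suc (suc n) f) (trans (cong (_+ f (suc n)) (total n)) (step n))

  avg-const : ∀ n c → avg n (λ _ → c) ≡ c
  avg-const n c = avg-closed (λ _ → c) (λ _ → c) refl step n
    where
    step : ∀ n → c * ι (suc n) + c ≡ c * ι (2 ℕ.+ n)
    step n rewrite ι-suc (suc n) = solve 2 (λ c x → c :* x :+ c := c :* (con 1ℚ :+ x)) refl c (ι (suc n))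

  avg-bound : ∀ n {f B} → (∀ a → a ℕ.≤ n → ∣ f a ∣ ≤ B) → ∣ avg n f ∣ ≤ B
  avg-bound n f≤B = ∑-bound-inv (List.length-upTo (suc n))
    (All.map (λ { (s≤s a≤n) → f≤B _ a≤n }) (All.all-upTo (suc n)))

  E-bound : ∀ n {g B} → (∀ k → k ℕ.≤ n ℕ.* n → ∣ g k ∣ ≤ B) → ∣ E n g ∣ ≤ B
  E-bound n g≤B = ∑-bound-inv {{n ℕₚ.!≢0}} (length-permutations n)
    (All.universal (λ σ → g≤B _ (inversions≤n*n σ)) (permutations n))

-- Falling factorials and factorial moments

fall : ℚ → ℕ → ℚ
fall x zero    = 1ℚ
fall x (suc s) = (x - ι s) * fall x s

P′-vanishes : ∀ {n s} → n ℕ.< s → n P′ s ≡ 0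
P′-vanishes {n} {suc s} (s≤s n≤s) = cong (ℕ._* (n P′ s)) (ℕₚ.m≤n⇒m∸n≡0 n≤s)

-- `P` tests s ≤ n and returns 0 otherwise; `P′` is the bare product, where truncated subtraction
-- supplies the factor 0.
P≡P′ : ∀ n s → n ℕ.P s ≡ n P′ s
P≡P′ n s with s ℕ.≤ᵇ n in eq
... | true  = refl
... | false = sym (P′-vanishes {n} {s} (ℕₚ.≰⇒> (λ s≤n → subst T eq (ℕₚ.≤⇒≤ᵇ s≤n))))

-- For n < s the truncated and the rational difference disagree, but the remaining product already
-- vanishes on both sides.
ι-P′ : ∀ n s → ι (n P′ s) ≡ fall (ι n) s
ι-P′ n zero    = ι-1
ι-P′ n (suc s) with ℕₚ.≤-<-connex s n
... | inj₁ s≤n = trans (ι-* (n ∸ s) (n P′ s)) (cong₂ _*_ (ι-∸ s≤n) (ι-P′ n s))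
... | inj₂ n<s = begin
  ι ((n ∸ s) ℕ.* (n P′ s))     ≡⟨ cong (λ p → ι ((n ∸ s) ℕ.* p)) (P′-vanishes n<s) ⟩
  ι ((n ∸ s) ℕ.* 0)            ≡⟨ cong ι (ℕₚ.*-zeroʳ (n ∸ s)) ⟩
  ι 0                          ≡⟨ ι-0 ⟩
  0ℚ                           ≡⟨ ℚₚ.*-zeroʳ (ι n - ι s) ⟨
  (ι n - ι s) * 0ℚ             ≡⟨ cong ((ι n - ι s) *_) (trans (cong ι (P′-vanishes n<s)) ι-0) ⟨
  (ι n - ι s) * ι (n P′ s)     ≡⟨ cong ((ι n - ι s) *_) (ι-P′ n s) ⟩
  (ι n - ι s) * fall (ι n) s   ∎
  where open ≡-Reasoning

P′≤^ : ∀ n s → n P′ s ℕ.≤ n ^ s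
P′≤^ n zero    = ℕₚ.≤-refl
P′≤^ n (suc s) = ℕₚ.*-mono-≤ (ℕₚ.m∸n≤m n s) (P′≤^ n s)

-- Bounding factor by factor would fail, because |n - j| exceeds n once j > 2n. The natural product
-- has 0 in place of such factors.
fall-bound : ∀ n s → ∣ fall (ι n) s ∣ ≤ ι (n ^ s)
fall-bound n s = subst (λ p → ∣ p ∣ ≤ ι (n ^ s)) (ι-P′ n s)
  (subst (_≤ ι (n ^ s)) (sym (∣ι∣ (n P′ s))) (ι-mono-≤ (P′≤^ n s)))

moment : ℕ → ℕ → ℚ
moment s n = E n (λ k → fall (ι k) s)

opaque

  unfolding E

  -- Grouping permutations by inversion number turns the counts `I n k` back into a sum over
  -- permutations; none has more than `n * n` inversions, so the cut-off loses nothing.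
  β≡moment : ∀ s n → β s n ≡ moment s n
  β≡moment s n = begin
    β s n
      ≡⟨ ∑-cong (λ k → trans (cong₂ _*_ (trans (fromℕ≡ι (k ℕ.P s)) (trans (cong ι (P≡P′ k s)) (ι-P′ k s)))
                                        (/≡ι*inv (I n k) (n !) {{n ℕₚ.!≢0}}))
                             (sym (ℚₚ.*-assoc (fall (ι k) s) _ _))) (upTo (suc (n ℕ.* n))) ⟩
    ∑ (upTo (suc (n ℕ.* n))) (λ k → fall (ι k) s * ι (I n k) * inv! n)
      ≡⟨ ∑-*ʳ (inv! n) (λ k → fall (ι k) s * ι (I n k)) (upTo (suc (n ℕ.* n))) ⟩
    ∑ (upTo (suc (n ℕ.* n))) (λ k → fall (ι k) s * ι (I n k)) * inv! n
      ≡⟨ cong (_* inv! n) (∑-fibres (λ k → fall (ι k) s) inversions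
           (All.universal (λ σ → s≤s (inversions≤n*n σ)) (permutations n))) ⟩
    moment s n
      ∎
    where open ≡-Reasoning

-- Vandermonde's identity to second order and the moment recurrence

-- The binomial coefficient C(t + 2, 2).
c₂ : ℕ → ℚ
c₂ zero    = 1ℚ
c₂ (suc t) = c₂ t + ι (2 ℕ.+ t)

-- The terms of degree at least 3 in x of Vandermonde's expansion
-- Σᵢ C(s,i) (x)ᵢ (y)ₛ₋ᵢ of (x + y)ₛ, where s = t + 2.
rem : ℕ → ℚ → ℚ → ℚ
rem zero    x y = 0ℚ
rem (suc t) x y = rem t x y * (x + y - ι (2 ℕ.+ t)) + c₂ t * fall x 3 * fall y t

-- Raising s by one multiplies by x + y - s = (x - i) + (y - (s - i)), which splits the term of
-- degree i into degrees i + 1 and i. Only the degree 2 term passes into the remainder, which is the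
-- new summand in `rem`.
fall-+ : ∀ t x y → fall (x + y) (2 ℕ.+ t) ≡
  fall y (2 ℕ.+ t) + x * (ι (2 ℕ.+ t) * fall y (1 ℕ.+ t)) + fall x 2 * (c₂ t * fall y t) + rem t x y
fall-+ zero    x y rewrite ι-suc 1 | ι-1 | ι-0 =
  solve 2 (λ x y →
      (x :+ y :- con 1ℚ) :* ((x :+ y :- con 0ℚ) :* con 1ℚ)
    := (y :- con 1ℚ) :* ((y :- con 0ℚ) :* con 1ℚ)
       :+ x :* ((con 1ℚ :+ con 1ℚ) :* ((y :- con 0ℚ) :* con 1ℚ))
       :+ (x :- con 1ℚ) :* ((x :- con 0ℚ) :* con 1ℚ) :* (con 1ℚ :* con 1ℚ) :+ con 0ℚ) refl x y
fall-+ (suc t) x y = trans (cong ((x + y - ι (2 ℕ.+ t)) *_) (fall-+ t x y)) expand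
  where
  expand : (x + y - ι (2 ℕ.+ t)) *
      (fall y (2 ℕ.+ t) + x * (ι (2 ℕ.+ t) * fall y (1 ℕ.+ t)) + fall x 2 * (c₂ t * fall y t) + rem t x y)
    ≡ fall y (3 ℕ.+ t) + x * (ι (3 ℕ.+ t) * fall y (2 ℕ.+ t)) + fall x 2 * (c₂ (suc t) * fall y (1 ℕ.+ t))
      + rem (suc t) x y
  expand rewrite ι-suc (2 ℕ.+ t) | ι-suc (1 ℕ.+ t) | ι-suc t | ι-suc 1 | ι-1 | ι-0 =
    solve 6 (λ x y T f c r →
      let f₁ = (y :- T) :* f
          f₂ = (y :- (con 1ℚ :+ T)) :* f₁
          s₂ = con 1ℚ :+ (con 1ℚ :+ T)
          f₃ = (y :- s₂) :* f₂
          x₂ = (x :- con 1ℚ) :* ((x :- con 0ℚ) :* con 1ℚ)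
          x₃ = (x :- (con 1ℚ :+ con 1ℚ)) :* x₂
      in (x :+ y :- s₂) :* (f₂ :+ x :* (s₂ :* f₁) :+ x₂ :* (c :* f) :+ r)
         := f₃ :+ x :* ((con 1ℚ :+ s₂) :* f₂) :+ x₂ :* ((c :+ s₂) :* f₁)
            :+ (r :* (x :+ y :- s₂) :+ c :* x₃ :* f))
      refl x y (ι t) (fall y t) (c₂ t) (rem t x y)

avg-ι : ∀ n → avg n ι ≡ ½ * ι n
avg-ι = avg-closed ι (λ n → ½ * ι n) base step
  where
  base : ι 0 ≡ ½ * ι 0
  base rewrite ι-0 = refl
  step : ∀ n → ½ * ι n * ι (suc n) + ι (suc n) ≡ ½ * ι (suc n) * ι (2 ℕ.+ n)
  step n rewrite ι-suc (suc n) | ι-suc n =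
    solve 1 (λ x → con ½ :* x :* (con 1ℚ :+ x) :+ (con 1ℚ :+ x)
      := con ½ :* (con 1ℚ :+ x) :* (con 1ℚ :+ (con 1ℚ :+ x))) refl (ι n)

⅓ : ℚ
⅓ = + 1 / 3

-- The hockey-stick sum of a(a - 1) over a ≤ n is (n + 1)n(n - 1)/3.
avg-fall₂ : ∀ n → avg n (λ a → fall (ι a) 2) ≡ ⅓ * (ι n * (ι n - 1ℚ))
avg-fall₂ = avg-closed (λ a → fall (ι a) 2) (λ n → ⅓ * (ι n * (ι n - 1ℚ))) base step
  where
  base : fall (ι 0) 2 ≡ ⅓ * (ι 0 * (ι 0 - 1ℚ))
  base rewrite ι-1 | ι-0 = refl
  step : ∀ n → ⅓ * (ι n * (ι n - 1ℚ)) * ι (suc n) + fall (ι (suc n)) 2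
             ≡ ⅓ * (ι (suc n) * (ι (suc n) - 1ℚ)) * ι (2 ℕ.+ n)
  step n rewrite ι-suc (suc n) | ι-suc n | ι-1 | ι-0 =
    solve 1 (λ x → con ⅓ :* (x :* (x :- con 1ℚ)) :* (con 1ℚ :+ x)
                   :+ (con 1ℚ :+ x :- con 1ℚ) :* ((con 1ℚ :+ x :- con 0ℚ) :* con 1ℚ)
      := con ⅓ :* ((con 1ℚ :+ x) :* (con 1ℚ :+ x :- con 1ℚ)) :* (con 1ℚ :+ (con 1ℚ :+ x))) refl (ι n)

avgRem : ℕ → ℕ → ℚ
avgRem t n = avg n (λ a → E n (λ k → rem t (ι a) (ι k)))

-- An exact recurrence: estimates enter only when `avgRem` is bounded.
moment-suc : ∀ t n → moment (2 ℕ.+ t) (suc n) ≡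
  moment (2 ℕ.+ t) n + ½ * ι n * (ι (2 ℕ.+ t) * moment (1 ℕ.+ t) n)
  + ⅓ * (ι n * (ι n - 1ℚ)) * (c₂ t * moment t n) + avgRem t n
moment-suc t n = begin
  moment (2 ℕ.+ t) (suc n)
    ≡⟨ E-suc n (λ k → fall (ι k) (2 ℕ.+ t)) ⟩
  avg n (λ a → E n (λ k → fall (ι (a ℕ.+ k)) (2 ℕ.+ t)))
    ≡⟨ avg-cong n inner ⟩
  avg n (λ a → m₂ + ι a * m₁ + fall (ι a) 2 * m₀ + r a)
    ≡⟨ avg-+ n (λ a → m₂ + ι a * m₁ + fall (ι a) 2 * m₀) r ⟩
  avg n (λ a → m₂ + ι a * m₁ + fall (ι a) 2 * m₀) + avgRem t n
    ≡⟨ cong (_+ avgRem t n) (avg-+ n (λ a → m₂ + ι a * m₁) (λ a → fall (ι a) 2 * m₀)) ⟩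
  avg n (λ a → m₂ + ι a * m₁) + avg n (λ a → fall (ι a) 2 * m₀) + avgRem t n
    ≡⟨ cong (λ p → p + avg n (λ a → fall (ι a) 2 * m₀) + avgRem t n) (avg-+ n (λ _ → m₂) (λ a → ι a * m₁)) ⟩
  avg n (λ _ → m₂) + avg n (λ a → ι a * m₁) + avg n (λ a → fall (ι a) 2 * m₀) + avgRem t n
    ≡⟨ cong (_+ avgRem t n) (cong₂ _+_ (cong₂ _+_ (avg-const n m₂)
         (trans (avg-*ʳ n m₁ ι) (cong (_* m₁) (avg-ι n))))
         (trans (avg-*ʳ n m₀ (λ a → fall (ι a) 2)) (cong (_* m₀) (avg-fall₂ n)))) ⟩
  m₂ + ½ * ι n * m₁ + ⅓ * (ι n * (ι n - 1ℚ)) * m₀ + avgRem t n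
    ∎
  where
  open ≡-Reasoning
  m₀ m₁ m₂ : ℚ
  m₀ = c₂ t * moment t n
  m₁ = ι (2 ℕ.+ t) * moment (1 ℕ.+ t) n
  m₂ = moment (2 ℕ.+ t) n
  r : ℕ → ℚ
  r a = E n (λ k → rem t (ι a) (ι k))
  inner : ∀ a → E n (λ k → fall (ι (a ℕ.+ k)) (2 ℕ.+ t)) ≡ m₂ + ι a * m₁ + fall (ι a) 2 * m₀ + r a
  inner a = begin
    E n (λ k → fall (ι (a ℕ.+ k)) (2 ℕ.+ t))
      ≡⟨ E-cong n (λ k → trans (cong (λ x → fall x (2 ℕ.+ t)) (ι-+ a k)) (fall-+ t (ι a) (ι k))) ⟩
    E n (λ k → g₂ k + g₁ k + g₀ k + rem t (ι a) (ι k))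
      ≡⟨ E-+ n (λ k → g₂ k + g₁ k + g₀ k) (λ k → rem t (ι a) (ι k)) ⟩
    E n (λ k → g₂ k + g₁ k + g₀ k) + r a
      ≡⟨ cong (_+ r a) (E-+ n (λ k → g₂ k + g₁ k) g₀) ⟩
    E n (λ k → g₂ k + g₁ k) + E n g₀ + r a
      ≡⟨ cong (λ p → p + E n g₀ + r a) (E-+ n g₂ g₁) ⟩
    m₂ + E n g₁ + E n g₀ + r a
      ≡⟨ cong (_+ r a) (cong₂ (λ p q → m₂ + p + q)
           (trans (E-*ˡ n (ι a) (λ k → ι (2 ℕ.+ t) * fall (ι k) (1 ℕ.+ t)))
                  (cong (ι a *_) (E-*ˡ n (ι (2 ℕ.+ t)) (λ k → fall (ι k) (1 ℕ.+ t)))))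
           (trans (E-*ˡ n (fall (ι a) 2) (λ k → c₂ t * fall (ι k) t))
                  (cong (fall (ι a) 2 *_) (E-*ˡ n (c₂ t) (λ k → fall (ι k) t))))) ⟩
    m₂ + ι a * m₁ + fall (ι a) 2 * m₀ + r a
      ∎
    where
    g₀ g₁ g₂ : ℕ → ℚ
    g₀ k = fall (ι a) 2 * (c₂ t * fall (ι k) t)
    g₁ k = ι a * (ι (2 ℕ.+ t) * fall (ι k) (1 ℕ.+ t))
    g₂ k = fall (ι k) (2 ℕ.+ t)

-- Orders of growth

-- n = 0 is left out: there 0 ^ d vanishes when d > 0, which would force f 0 = 0.
record IsO (d : ℕ) (f : ℕ → ℚ) : Set where
  constructor isO
  field
    constant : ℕ
    bound    : ∀ n → ∣ f (suc n) ∣ ≤ ι (constant ℕ.* suc n ^ d)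

private variable
  d e : ℕ
  f g : ℕ → ℚ

IsO-cong : (∀ n → f n ≡ g n) → IsO d f → IsO d g
IsO-cong {d = d} eq (isO C f≤) = isO C λ n → subst (λ p → ∣ p ∣ ≤ ι (C ℕ.* suc n ^ d)) (eq (suc n)) (f≤ n)

IsO-+ : IsO d f → IsO d g → IsO d (λ n → f n + g n)
IsO-+ {d} {f} {g} (isO C f≤) (isO D g≤) = isO (C ℕ.+ D) λ n →
  subst (λ b → ∣ f (suc n) + g (suc n) ∣ ≤ ι b) (sym (ℕₚ.*-distribʳ-+ (suc n ^ d) C D))
        (+-mono-≤-ι {f (suc n)} {g (suc n)} (f≤ n) (g≤ n))

IsO-* : IsO d f → IsO e g → IsO (d ℕ.+ e) (λ n → f n * g n)
IsO-* {d} {f} {e} {g} (isO C f≤) (isO D g≤) = isO (C ℕ.* D) λ n →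
  subst (λ b → ∣ f (suc n) * g (suc n) ∣ ≤ ι b)
        (trans (ℕₚ.[m*n]*[o*p]≡[m*o]*[n*p] C (suc n ^ d) D (suc n ^ e))
               (cong (C ℕ.* D ℕ.*_) (sym (ℕₚ.^-distribˡ-+-* (suc n) d e))))
        (*-mono-≤-ι {f (suc n)} {g (suc n)} (f≤ n) (g≤ n))

IsO-suc : IsO d f → IsO (suc d) f
IsO-suc {d} (isO C f≤) = isO C λ n →
  ℚₚ.≤-trans (f≤ n) (ι-mono-≤ (ℕₚ.*-monoʳ-≤ C (ℕₚ.m≤n*m (suc n ^ d) (suc n))))

IsO-const : ∀ p → IsO 0 (λ _ → p)
IsO-const p = isO (ℤ.∣ ↥ p ∣) λ n →
  subst (λ b → ∣ p ∣ ≤ ι b) (sym (ℕₚ.*-identityʳ ℤ.∣ ↥ p ∣)) (∣p∣≤ι∣↥p∣ p)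

IsO-^ : ∀ d → IsO d (λ n → ι (n ^ d))
IsO-^ d = isO 1 λ n → ℚₚ.≤-reflexive (trans (∣ι∣ (suc n ^ d)) (cong ι (sym (ℕₚ.*-identityˡ (suc n ^ d)))))

IsO-ι : IsO 1 ι
IsO-ι = IsO-cong (λ n → cong ι (ℕₚ.*-identityʳ n)) (IsO-^ 1)

IsO-*ι : IsO d f → IsO (suc d) (λ n → ι n * f n)
IsO-*ι = IsO-* IsO-ι

IsO-*ˡ : ∀ c → IsO d f → IsO d (λ n → c * f n)
IsO-*ˡ c = IsO-* (IsO-const c)

-- f (n + 1) is f 1 plus n increments of size at most C (n + 1)^d; the constant f 1 is absorbed
-- because (n + 1)^{d+1} is at least 1.
IsO-telescope : IsO d (λ n → f (suc n) - f n) → IsO (suc d) f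
IsO-telescope {d} {f} (isO C Δf≤) = isO (C₀ ℕ.+ C) λ n → ℚₚ.≤-trans (partial n) (ι-mono-≤ (total n))
  where
  C₀ = ℤ.∣ ↥ f 1 ∣
  partial : ∀ n → ∣ f (suc n) ∣ ≤ ι (C₀ ℕ.+ n ℕ.* (C ℕ.* suc n ^ d))
  partial zero    = subst (λ b → ∣ f 1 ∣ ≤ ι b) (sym (ℕₚ.+-identityʳ C₀)) (∣p∣≤ι∣↥p∣ (f 1))
  partial (suc n) = begin
    ∣ f (2 ℕ.+ n) ∣
      ≡⟨ cong ∣_∣ (solve 2 (λ p q → p := (p :- q) :+ q) refl (f (2 ℕ.+ n)) (f (suc n))) ⟩
    ∣ (f (2 ℕ.+ n) - f (suc n)) + f (suc n) ∣
      ≤⟨ +-mono-≤-ι {f (2 ℕ.+ n) - f (suc n)} {f (suc n)} (Δf≤ n) (partial n) ⟩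
    ι (C ℕ.* suc n ^ d ℕ.+ (C₀ ℕ.+ n ℕ.* (C ℕ.* suc n ^ d)))
      -- All increments are measured by the newest power; this keeps the bound in closed form and
      -- costs no order of growth.
      ≤⟨ ι-mono-≤ (ℕₚ.≤-trans (ℕₚ.≤-reflexive (swap (C ℕ.* suc n ^ d) C₀ (n ℕ.* (C ℕ.* suc n ^ d))))
           (ℕₚ.+-monoʳ-≤ C₀ (ℕₚ.*-monoʳ-≤ (suc n) (ℕₚ.*-monoʳ-≤ C (ℕₚ.^-monoˡ-≤ d (ℕₚ.n≤1+n (suc n))))))) ⟩
    ι (C₀ ℕ.+ suc n ℕ.* (C ℕ.* (2 ℕ.+ n) ^ d))
      ∎
    where
    open ℚₚ.≤-Reasoning
    swap : ∀ x y z → x ℕ.+ (y ℕ.+ z) ≡ y ℕ.+ (x ℕ.+ z)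
    swap x y z = trans (sym (ℕₚ.+-assoc x y z)) (trans (cong (ℕ._+ z) (ℕₚ.+-comm x y)) (ℕₚ.+-assoc y x z))
  total : ∀ n → C₀ ℕ.+ n ℕ.* (C ℕ.* suc n ^ d) ℕ.≤ (C₀ ℕ.+ C) ℕ.* suc n ^ suc d
  total n = begin
    C₀ ℕ.+ n ℕ.* (C ℕ.* suc n ^ d)
      ≤⟨ ℕₚ.+-mono-≤ (ℕₚ.m≤m*n C₀ (suc n ^ suc d) {{ℕₚ.m^n≢0 (suc n) (suc d)}})
                     (ℕₚ.*-monoˡ-≤ (C ℕ.* suc n ^ d) (ℕₚ.n≤1+n n)) ⟩
    C₀ ℕ.* suc n ^ suc d ℕ.+ suc n ℕ.* (C ℕ.* suc n ^ d)
      ≡⟨ N.solve 4 (λ b c x p → b N.:* (x N.:* p) N.:+ x N.:* (c N.:* p) N.:= (b N.:+ c) N.:* (x N.:* p)) refl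
           C₀ C (suc n) (suc n ^ d) ⟩
    (C₀ ℕ.+ C) ℕ.* suc n ^ suc d
      ∎
    where
    open ℕₚ.≤-Reasoning
    module N = ℕSolver.+-*-Solver

-- The terms of degree at least 3 are small

[n*n]^t : ∀ n t → (n ℕ.* n) ^ t ≡ n ^ (t ℕ.* 2)
[n*n]^t n zero    = refl
[n*n]^t n (suc t) = trans (cong (n ℕ.* n ℕ.*_) ([n*n]^t n t)) (ℕₚ.*-assoc n n _)

-- With x of weight 1 and y of weight 2, each step of `rem` multiplies by a factor of weight 2 and
-- adds (x)₃ (y)ₜ, of weight 3 + 2t.
rem-bound : ∀ t → ∃[ C ] ∀ n {a k} → a ℕ.≤ suc n → k ℕ.≤ suc n ℕ.* suc n →
  ∣ rem t (ι a) (ι k) ∣ ≤ ι (C ℕ.* suc n ^ suc (t ℕ.* 2))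
rem-bound zero    = 0 , λ n _ _ → 0≤ι 0
rem-bound (suc t) with rem-bound t
-- 4 + t comes from |x + y - (t + 2)| ≤ N² + N² + (t + 2)N², and `C₂` bounds the coefficient `c₂ t`.
... | C , rem≤ = C ℕ.* (4 ℕ.+ t) ℕ.+ C₂ , λ n {a} {k} a≤N k≤N² →
  let N = suc n in
  subst (λ b → ∣ rem (suc t) (ι a) (ι k) ∣ ≤ ι b)
    (N.solve 5 (λ c s d x p → c N.:* p N.:* (s N.:* (x N.:* x)) N.:+ d N.:* (x N.:* (x N.:* p))
       N.:= (c N.:* s N.:+ d) N.:* (x N.:* (x N.:* p))) refl C (4 ℕ.+ t) C₂ N (N ^ suc (t ℕ.* 2)))
    (+-mono-≤-ι {rem t (ι a) (ι k) * (ι a + ι k - ι (2 ℕ.+ t))} {c₂ t * fall (ι a) 3 * fall (ι k) t}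
      (*-mono-≤-ι {rem t (ι a) (ι k)} {ι a + ι k - ι (2 ℕ.+ t)} (rem≤ n a≤N k≤N²) (linear n a≤N k≤N²))
      (falling n a≤N k≤N²))
  where
  module N = ℕSolver.+-*-Solver
  C₂ = ℤ.∣ ↥ c₂ t ∣
  linear : ∀ n {a k} → a ℕ.≤ suc n → k ℕ.≤ suc n ℕ.* suc n →
    ∣ ι a + ι k - ι (2 ℕ.+ t) ∣ ≤ ι ((4 ℕ.+ t) ℕ.* (suc n ℕ.* suc n))
  linear n {a} {k} a≤N k≤N² = ℚₚ.≤-trans
    (+-mono-≤-ι {ι a + ι k} { - ι (2 ℕ.+ t)} {a ℕ.+ k} {2 ℕ.+ t}
      (ℚₚ.≤-reflexive (trans (cong ∣_∣ (sym (ι-+ a k))) (∣ι∣ (a ℕ.+ k))))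
      (ℚₚ.≤-reflexive (trans (ℚₚ.∣-p∣≡∣p∣ (ι (2 ℕ.+ t))) (∣ι∣ (2 ℕ.+ t)))))
    (ι-mono-≤ (ℕₚ.≤-trans (ℕₚ.≤-reflexive (ℕₚ.+-assoc a k (2 ℕ.+ t)))
      (ℕₚ.+-mono-≤ (ℕₚ.≤-trans a≤N (ℕₚ.m≤m*n (suc n) (suc n)))
        (ℕₚ.+-mono-≤ k≤N² (ℕₚ.m≤m*n (2 ℕ.+ t) (suc n ℕ.* suc n))))))
  falling : ∀ n {a k} → a ℕ.≤ suc n → k ℕ.≤ suc n ℕ.* suc n →
    ∣ c₂ t * fall (ι a) 3 * fall (ι k) t ∣ ≤ ι (C₂ ℕ.* (suc n ^ (3 ℕ.+ t ℕ.* 2)))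
  falling n {a} {k} a≤N k≤N² = subst (λ b → ∣ c₂ t * fall (ι a) 3 * fall (ι k) t ∣ ≤ ι b)
    (trans (ℕₚ.*-assoc C₂ (suc n ^ 3) (suc n ^ (t ℕ.* 2)))
           (cong (C₂ ℕ.*_) (sym (ℕₚ.^-distribˡ-+-* (suc n) 3 (t ℕ.* 2)))))
    (*-mono-≤-ι {c₂ t * fall (ι a) 3} {fall (ι k) t}
      (*-mono-≤-ι {c₂ t} {fall (ι a) 3} (∣p∣≤ι∣↥p∣ (c₂ t))
        (ℚₚ.≤-trans (fall-bound a 3) (ι-mono-≤ (ℕₚ.^-monoˡ-≤ 3 a≤N))))
      (ℚₚ.≤-trans (fall-bound k t) (ι-mono-≤ (ℕₚ.≤-trans (ℕₚ.^-monoˡ-≤ t k≤N²)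
        (ℕₚ.≤-reflexive ([n*n]^t (suc n) t))))))

IsO-avgRem : ∀ t → IsO (suc (t ℕ.* 2)) (avgRem t)
IsO-avgRem t with rem-bound t
... | C , rem≤ = isO C λ n → avg-bound (suc n) (λ a a≤N → E-bound (suc n) (λ k k≤N² → rem≤ n a≤N k≤N²))

-- Binomial expansion of powers of n + 1

power-remainder : ℕ → ℕ → ℚ
power-remainder d n = ι (suc n ^ (3 ℕ.+ d)) -
  (ι (n ^ (3 ℕ.+ d)) + ι (3 ℕ.+ d) * ι (n ^ (2 ℕ.+ d)) + c₂ (suc d) * ι (n ^ (1 ℕ.+ d)))

-- Multiplying the expansion by n + 1 multiplies the remainder by n + 1 and pushes one further term,
-- C(d + 3, 2) n^{d+1}, out of the three retained ones.
IsO-power-remainder : ∀ d → IsO d (power-remainder d)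
IsO-power-remainder zero    = IsO-cong base (IsO-const 1ℚ)
  where
  base : ∀ n → 1ℚ ≡ power-remainder 0 n
  base n rewrite ι-* (suc n) (suc n ^ 2) | ι-* (suc n) (suc n ^ 1) | ι-* (suc n) 1
               | ι-* n (n ^ 2) | ι-* n (n ^ 1) | ι-* n 1 | ι-suc n | ι-suc 2 | ι-suc 1 | ι-1 =
    solve 1 (λ x → let one = con 1ℚ; x₁ = one :+ x in
      one := x₁ :* (x₁ :* (x₁ :* one)) :- (x :* (x :* (x :* one)) :+ (one :+ (one :+ one)) :* (x :* (x :* one))
        :+ (one :+ (one :+ one)) :* (x :* one))) refl (ι n)
IsO-power-remainder (suc d) = IsO-cong step
  (IsO-+ (IsO-*ι (IsO-power-remainder d)) (IsO-+ (IsO-suc (IsO-power-remainder d))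
         (IsO-*ˡ (c₂ (suc d)) (IsO-^ (suc d)))))
  where
  step : ∀ n → ι n * power-remainder d n + (power-remainder d n + c₂ (suc d) * ι (n ^ suc d)) ≡ power-remainder (suc d) n
  step n rewrite ι-* (suc n) (suc n ^ (3 ℕ.+ d)) | ι-* n (n ^ (3 ℕ.+ d)) | ι-* n (n ^ (2 ℕ.+ d)) | ι-* n (n ^ (1 ℕ.+ d))
               | ι-suc n | ι-suc (3 ℕ.+ d) =
    solve 5 (λ x p q s c →
      let r = p :- (x :* (x :* q) :+ s :* (x :* q) :+ c :* q)
      in x :* r :+ (r :+ c :* q)
         := (con 1ℚ :+ x) :* p :- (x :* (x :* (x :* q)) :+ (con 1ℚ :+ s) :* (x :* (x :* q)) :+ (c :+ s) :* (x :* q)))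
      refl (ι n) (ι (suc n ^ (3 ℕ.+ d))) (ι (n ^ (1 ℕ.+ d))) (ι (3 ℕ.+ d)) (c₂ (suc d))

-- The coefficients of the main terms

α : ℕ → ℚ
α s = inv (4 ^ s) {{m^n≢0 4 s}}

α-suc : ∀ s → α s ≡ fromℕ 4 * α (suc s)
α-suc s = begin
  α s                   ≡⟨ ℚₚ.*-identityˡ (α s) ⟨
  1ℚ * α s              ≡⟨ cong (_* α s) (ι-inv 4) ⟨
  ι 4 * inv 4 * α s     ≡⟨ ℚₚ.*-assoc (ι 4) (inv 4) (α s) ⟩
  ι 4 * (inv 4 * α s)   ≡⟨ cong₂ _*_ (fromℕ≡ι 4) (inv-* 4 (4 ^ s) {{_}} {{m^n≢0 4 s}} {{m^n≢0 4 (suc s)}}) ⟨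
  fromℕ 4 * α (suc s)   ∎
  where open ≡-Reasoning

-- Comparing coefficients of n^{2s-2} in the recurrence demands (2s - 1)(s + ρ(s)) = 2s ρ(s - 1) +
-- 8s(s - 1)/3, and this quadratic is the solution. The argument is rational so that the ring solver
-- can expand it at 1 + T and 2 + T.
ρ : ℚ → ℚ
ρ s = (+ 1 / 9) * (s * (fromℕ 2 * s - fromℕ 11))

γ : ℕ → ℚ
γ s = α s * ρ (ι s)

c₂-closed : ∀ t → c₂ t ≡ ½ * ((fromℕ 2 + ι t) * (1ℚ + ι t))
c₂-closed zero    rewrite ι-0 = refl
c₂-closed (suc t) rewrite c₂-closed t | ι-suc (suc t) | ι-suc t =
  solve 1 (λ x → con ½ :* ((con (fromℕ 2) :+ x) :* (con 1ℚ :+ x)) :+ (con 1ℚ :+ (con 1ℚ :+ x))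
    := con ½ :* ((con (fromℕ 2) :+ (con 1ℚ :+ x)) :* (con 1ℚ :+ (con 1ℚ :+ x)))) refl (ι t)

-- Recurrence for the error terms

-- The error term of the theorem for s = t + 1.
residual : ℕ → ℕ → ℚ
residual t n = moment (suc t) n - (α (suc t) * ι (n ^ (2 ℕ.+ t ℕ.* 2)) + γ (suc t) * ι (n ^ (1 ℕ.+ t ℕ.* 2)))

-- The factor n avoids the exponent 2t - 1, which is negative for t = 0.
weakResidual : ℕ → ℕ → ℚ
weakResidual t n = ι n * moment t n - α t * ι (n ^ (1 ℕ.+ t ℕ.* 2))

-- The hypotheses name the dependent terms of residual-suc, so that only the
-- eleven independent ones reach the ring solver.
residual-identity : ∀ {T x z a m₂ m₁ m₀ r p₄ p₃ κ a₁ a₀ s₁ s₂ D D₂ D₃ D₄ c K z₁ z₂ z₃ z₄} →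
  a₁ ≡ fromℕ 4 * a → a₀ ≡ fromℕ 4 * a₁ → s₁ ≡ 1ℚ + T → s₂ ≡ 1ℚ + s₁ →
  D ≡ T * fromℕ 2 → D₂ ≡ 1ℚ + (1ℚ + D) → D₃ ≡ 1ℚ + D₂ → D₄ ≡ 1ℚ + D₃ →
  c ≡ ½ * ((fromℕ 2 + T) * (1ℚ + T)) → K ≡ ½ * ((fromℕ 2 + D₂) * (1ℚ + D₂)) →
  z₁ ≡ x * z → z₂ ≡ x * z₁ → z₃ ≡ x * z₂ → z₄ ≡ x * z₃ →
  s₂ * ½ * (x * (m₁ - (a₁ * z₂ + a₁ * ρ s₁ * z₁)))
  + (c * ⅓ * (x * (x * m₀ - a₀ * z₁))
  + (- (c * ⅓) * (x * m₀ - a₀ * z₁)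
  + (r
  + (- a * (p₄ - (z₄ + D₄ * z₃ + K * z₂))
  + (- (a * ρ s₂) * (p₃ - (z₃ + D₃ * z₂ + κ * z₁))
  + - (c * ⅓ * a₀ + a * ρ s₂ * κ) * z₁)))))
  ≡ m₂ + ½ * x * (s₂ * m₁) + ⅓ * (x * (x - 1ℚ)) * (c * m₀) + r - (a * p₄ + a * ρ s₂ * p₃)
    - (m₂ - (a * z₄ + a * ρ s₂ * z₃))
residual-identity {T} {x} {z} {a} {m₂} {m₁} {m₀} {r} {p₄} {p₃} {κ}
  refl refl refl refl refl refl refl refl refl refl refl refl refl refl =
  -- With s = t + 2, `z₃` and `z₂` stand for n^{2s-1} and n^{2s-2}, whose coefficients must cancel.
  -- `K` = C(2s, 2) takes part in this and is expanded; `κ` meets only `z₁`, cancels as it stands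
  -- and remains a variable.
  solve 11 (λ T x z a m₂ m₁ m₀ r p₄ p₃ κ →
    let one = con 1ℚ
        two = con (fromℕ 2)
        ρ′  = λ s → con (+ 1 / 9) :* (s :* (two :* s :- con (fromℕ 11)))
        a₁  = con (fromℕ 4) :* a
        a₀  = con (fromℕ 4) :* a₁
        s₁  = one :+ T
        s₂  = one :+ s₁
        g₁  = a₁ :* ρ′ s₁
        g₂  = a :* ρ′ s₂
        c   = con ½ :* ((two :+ T) :* (one :+ T))
        D₂  = one :+ (one :+ T :* two)
        D₃  = one :+ D₂
        D₄  = one :+ D₃
        K   = con ½ :* ((two :+ D₂) :* (one :+ D₂))
        z₁  = x :* z
        z₂  = x :* z₁
        z₃  = x :* z₂
        z₄  = x :* z₃
        R₀  = x :* m₀ :- a₀ :* z₁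
    in s₂ :* con ½ :* (x :* (m₁ :- (a₁ :* z₂ :+ g₁ :* z₁)))
       :+ (c :* con ⅓ :* (x :* R₀)
       :+ ((:- (c :* con ⅓)) :* R₀
       :+ (r
       :+ ((:- a) :* (p₄ :- (z₄ :+ D₄ :* z₃ :+ K :* z₂))
       :+ ((:- g₂) :* (p₃ :- (z₃ :+ D₃ :* z₂ :+ κ :* z₁))
       :+ (:- (c :* con ⅓ :* a₀ :+ g₂ :* κ)) :* z₁)))))
       := (m₂ :+ con ½ :* x :* (s₂ :* m₁) :+ con ⅓ :* (x :* (x :- one)) :* (c :* m₀) :+ r
             :- (a :* p₄ :+ g₂ :* p₃))
          :- (m₂ :- (a :* z₄ :+ g₂ :* z₃)))
    refl T x z a m₂ m₁ m₀ r p₄ p₃ κ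

-- In `moment-suc` the lower moments are replaced by main term plus error, with n(n - 1) β_t read as
-- (n - 1) times n β_t to fit `weakResidual`, and the powers of n + 1 are expanded. What survives
-- the cancellation is of order n^{2t+1} summand by summand.
residual-suc : ∀ t n → let d = t ℕ.* 2 in
  ι (2 ℕ.+ t) * ½ * (ι n * residual t n)
  + (c₂ t * ⅓ * (ι n * weakResidual t n)
  + (- (c₂ t * ⅓) * weakResidual t n
  + (avgRem t n
  + (- α (2 ℕ.+ t) * power-remainder (1 ℕ.+ d) n
  + (- γ (2 ℕ.+ t) * power-remainder d n
  + - (c₂ t * ⅓ * α t + γ (2 ℕ.+ t) * c₂ (1 ℕ.+ d)) * ι (n ^ (1 ℕ.+ d)))))))
  ≡ residual (suc t) (suc n) - residual (suc t) n
residual-suc t n = trans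
  (residual-identity {T = ι t} {x = ι n} {ι (n ^ 2t)} {α (2 ℕ.+ t)}
    {moment (2 ℕ.+ t) n} {moment (1 ℕ.+ t) n} {moment t n} {avgRem t n}
    {ι (suc n ^ (4 ℕ.+ 2t))} {ι (suc n ^ (3 ℕ.+ 2t))} {c₂ (1 ℕ.+ 2t)} {D = ι 2t}
    (α-suc (1 ℕ.+ t)) (α-suc t) (ι-suc t) (ι-suc (1 ℕ.+ t))
    (trans (ι-* t 2) (cong (ι t *_) (sym (fromℕ≡ι 2))))
    (trans (ι-suc (1 ℕ.+ 2t)) (cong (_+_ 1ℚ) (ι-suc 2t))) (ι-suc (2 ℕ.+ 2t)) (ι-suc (3 ℕ.+ 2t))
    (c₂-closed t) (c₂-closed (2 ℕ.+ 2t))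
    (ι-* n (n ^ 2t)) (ι-* n (n ^ (1 ℕ.+ 2t))) (ι-* n (n ^ (2 ℕ.+ 2t))) (ι-* n (n ^ (3 ℕ.+ 2t))))
  (cong (λ m → m - (α (2 ℕ.+ t) * ι (suc n ^ (4 ℕ.+ 2t)) + γ (2 ℕ.+ t) * ι (suc n ^ (3 ℕ.+ 2t)))
               - residual (suc t) n) (sym (moment-suc t n)))
  where 2t = t ℕ.* 2

-- Base cases

moment-0 : ∀ n → moment 0 n ≡ 1ℚ
moment-0 zero    = E-0 (λ _ → 1ℚ)
moment-0 (suc n) = trans (E-suc n (λ _ → 1ℚ)) (trans (avg-const n (moment 0 n)) (moment-0 n))

moment-1-suc : ∀ n → moment 1 (suc n) ≡ ½ * ι n + moment 1 n
moment-1-suc n = begin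
  moment 1 (suc n)
    ≡⟨ E-suc n (λ k → fall (ι k) 1) ⟩
  avg n (λ a → E n (λ k → fall (ι (a ℕ.+ k)) 1))
    ≡⟨ avg-cong n inner ⟩
  avg n (λ a → ι a + moment 1 n)
    ≡⟨ avg-+ n ι (λ _ → moment 1 n) ⟩
  avg n ι + avg n (λ _ → moment 1 n)
    ≡⟨ cong₂ _+_ (avg-ι n) (avg-const n (moment 1 n)) ⟩
  ½ * ι n + moment 1 n
    ∎
  where
  open ≡-Reasoning
  inner : ∀ a → E n (λ k → fall (ι (a ℕ.+ k)) 1) ≡ ι a + moment 1 n
  inner a = begin
    E n (λ k → fall (ι (a ℕ.+ k)) 1)
      ≡⟨ E-cong n (λ k → trans (cong (λ x → fall x 1) (ι-+ a k))
           (solve 3 (λ x y o → (x :+ y :- o) :* con 1ℚ := x :* con 1ℚ :+ (y :- o) :* con 1ℚ) refl (ι a) (ι k) (ι 0))) ⟩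
    E n (λ k → ι a * 1ℚ + fall (ι k) 1)
      ≡⟨ E-+ n (λ _ → ι a * 1ℚ) (λ k → fall (ι k) 1) ⟩
    E n (λ _ → ι a * 1ℚ) + moment 1 n
      ≡⟨ cong (_+ moment 1 n) (trans (E-*ˡ n (ι a) (λ _ → 1ℚ))
           (trans (cong (ι a *_) (moment-0 n)) (ℚₚ.*-identityʳ (ι a)))) ⟩
    ι a + moment 1 n
      ∎

moment-1 : ∀ n → moment 1 n ≡ (+ 1 / 4) * (ι n * (ι n - 1ℚ))
moment-1 zero    = trans (E-0 (λ k → fall (ι k) 1)) base
  where
  base : fall (ι 0) 1 ≡ (+ 1 / 4) * (ι 0 * (ι 0 - 1ℚ))
  base rewrite ι-0 = refl
moment-1 (suc n) = trans (moment-1-suc n) (trans (cong (_+_ (½ * ι n)) (moment-1 n)) step)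
  where
  step : ½ * ι n + (+ 1 / 4) * (ι n * (ι n - 1ℚ)) ≡ (+ 1 / 4) * (ι (suc n) * (ι (suc n) - 1ℚ))
  step rewrite ι-suc n =
    solve 1 (λ x → con ½ :* x :+ con (+ 1 / 4) :* (x :* (x :- con 1ℚ))
      := con (+ 1 / 4) :* ((con 1ℚ :+ x) :* (con 1ℚ :+ x :- con 1ℚ))) refl (ι n)

α-1 : α 1 ≡ + 1 / 4
α-1 = sym (trans (/≡ι*inv 1 4) (trans (cong (_* inv 4) ι-1) (ℚₚ.*-identityˡ (inv 4))))

-- For s = 1 the two main terms are exact: the mean is n(n - 1)/4, and ρ(1) = -1.
residual-0 : ∀ n → 0ℚ ≡ residual 0 n
residual-0 n = trans closed
  (cong (_- (α 1 * ι (n ^ 2) + γ 1 * ι (n ^ 1))) (sym (moment-1 n)))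
  where
  closed : 0ℚ ≡ (+ 1 / 4) * (ι n * (ι n - 1ℚ)) - (α 1 * ι (n ^ 2) + γ 1 * ι (n ^ 1))
  closed rewrite α-1 | ι-* n (n ^ 1) | ι-* n 1 | ι-1 =
    solve 1 (λ x → con 0ℚ := con (+ 1 / 4) :* (x :* (x :- con 1ℚ))
      :- (con (+ 1 / 4) :* (x :* (x :* con 1ℚ)) :+ con ((+ 1 / 4) * ρ 1ℚ) :* (x :* con 1ℚ))) refl (ι n)

weakResidual-0 : ∀ n → 0ℚ ≡ weakResidual 0 n
weakResidual-0 n = trans closed (cong (λ m → ι n * m - α 0 * ι (n ^ 1)) (sym (moment-0 n)))
  where
  closed : 0ℚ ≡ ι n * 1ℚ - α 0 * ι (n ^ 1)
  closed rewrite inv-1 | ι-* n 1 | ι-1 =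
    solve 1 (λ x → con 0ℚ := x :* con 1ℚ :- con 1ℚ :* (x :* con 1ℚ)) refl (ι n)

-- Induction on the order of the moment

-- The recurrence reaches back two moments. Since `residual t` concerns β_{t+1} and `weakResidual t`
-- concerns β_t, both are needed at the same `t`, and the mutual recursion is structural.
IsO-residual : ∀ t → IsO (t ℕ.* 2) (residual t)
IsO-weakResidual : ∀ t → IsO (t ℕ.* 2) (weakResidual t)

IsO-residual zero    = IsO-cong residual-0 (IsO-const 0ℚ)
IsO-residual (suc t) = IsO-telescope (IsO-cong (residual-suc t)
  (IsO-+ (IsO-*ˡ (ι (2 ℕ.+ t) * ½) (IsO-*ι (IsO-residual t)))
  (IsO-+ (IsO-*ˡ (c₂ t * ⅓) (IsO-*ι (IsO-weakResidual t)))
  (IsO-+ (IsO-*ˡ (- (c₂ t * ⅓)) (IsO-suc (IsO-weakResidual t)))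
  (IsO-+ (IsO-avgRem t)
  (IsO-+ (IsO-*ˡ (- α (2 ℕ.+ t)) (IsO-power-remainder (1 ℕ.+ t ℕ.* 2)))
  (IsO-+ (IsO-*ˡ (- γ (2 ℕ.+ t)) (IsO-suc (IsO-power-remainder (t ℕ.* 2))))
         (IsO-*ˡ (- (c₂ t * ⅓ * α t + γ (2 ℕ.+ t) * c₂ (1 ℕ.+ t ℕ.* 2))) (IsO-^ (1 ℕ.+ t ℕ.* 2))))))))))

IsO-weakResidual zero    = IsO-cong weakResidual-0 (IsO-const 0ℚ)
-- The coarse error is n times the fine one with the second main term added back.
IsO-weakResidual (suc t) = IsO-cong split
  (IsO-+ (IsO-suc (IsO-*ι (IsO-residual t))) (IsO-*ˡ (γ (suc t)) (IsO-^ (2 ℕ.+ t ℕ.* 2))))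
  where
  split : ∀ n → ι n * residual t n + γ (suc t) * ι (n ^ (2 ℕ.+ t ℕ.* 2)) ≡ weakResidual (suc t) n
  split n rewrite ι-* n (n ^ (2 ℕ.+ t ℕ.* 2)) | ι-* n (n ^ (1 ℕ.+ t ℕ.* 2)) =
    solve 5 (λ x m a g z → x :* (m :- (a :* (x :* z) :+ g :* z)) :+ g :* (x :* z) := x :* m :- a :* (x :* (x :* z)))
      refl (ι n) (moment (suc t) n) (α (suc t)) (γ (suc t)) (ι (n ^ (1 ℕ.+ t ℕ.* 2)))

-- Translation to the stated form

fromℤ-coefficient : ∀ s → fromℤ (+ s ℤ.* (+ (2 ℕ.* s) ℤ.- + 11)) ≡ ι s * (fromℕ 2 * ι s - fromℕ 11)
fromℤ-coefficient s = begin
  fromℤ (+ s ℤ.* (+ (2 ℕ.* s) ℤ.- + 11))              ≡⟨ fromℤ-* (+ s) (+ (2 ℕ.* s) ℤ.- + 11) ⟩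
  fromℕ s * fromℤ (+ (2 ℕ.* s) ℤ.- + 11)              ≡⟨ cong (fromℕ s *_) (fromℤ-+ (+ (2 ℕ.* s)) (ℤ.- + 11)) ⟩
  fromℕ s * (fromℕ (2 ℕ.* s) - fromℕ 11)              ≡⟨ cong₂ (λ p q → p * (q - fromℕ 11)) (fromℕ≡ι s)
                                                           (trans (fromℕ≡ι (2 ℕ.* s)) (trans (ι-* 2 s) (cong (_* ι s) (sym (fromℕ≡ι 2))))) ⟩
  ι s * (fromℕ 2 * ι s - fromℕ 11)                    ∎
  where open ≡-Reasoning

coefficient≡γ : ∀ s → ((+ s ℤ.* (+ (2 ℕ.* s) ℤ.- + 11)) / (9 ℕ.* 4 ^ s)) {{m*n≢0 9 (4 ^ s) {{_}} {{m^n≢0 4 s}}}} ≡ γ s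
coefficient≡γ s = begin
  (i / (9 ℕ.* 4 ^ s)) {{nz}}                          ≡⟨ /≡fromℤ*inv i (9 ℕ.* 4 ^ s) {{nz}} ⟩
  fromℤ i * inv (9 ℕ.* 4 ^ s) {{nz}}                  ≡⟨ cong₂ _*_ (fromℤ-coefficient s) (inv-* 9 (4 ^ s) {{_}} {{m^n≢0 4 s}} {{nz}}) ⟩
  ι s * (fromℕ 2 * ι s - fromℕ 11) * (inv 9 * α s)    ≡⟨ cong (λ q → ι s * (fromℕ 2 * ι s - fromℕ 11) * (q * α s)) inv-9 ⟩
  ι s * (fromℕ 2 * ι s - fromℕ 11) * ((+ 1 / 9) * α s)
    ≡⟨ solve 3 (λ x y a → x :* y :* (con (+ 1 / 9) :* a) := a :* (con (+ 1 / 9) :* (x :* y))) refl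
         (ι s) (fromℕ 2 * ι s - fromℕ 11) (α s) ⟩
  γ s                                                 ∎
  where
  open ≡-Reasoning
  i = + s ℤ.* (+ (2 ℕ.* s) ℤ.- + 11)
  nz = m*n≢0 9 (4 ^ s) {{_}} {{m^n≢0 4 s}}
  inv-9 : inv 9 ≡ + 1 / 9
  inv-9 = sym (trans (/≡ι*inv 1 9) (trans (cong (_* inv 9) ι-1) (ℚₚ.*-identityˡ (inv 9))))

theorem3p1 :
  ∀ (s : ℕ) → 1 ℕ.≤ s →
  let instance
        _ = m^n≢0 4 s
        _ = m*n≢0 9 (4 ^ s)
  in
  (λ n → β s n - ( + (n ^ (2 ℕ.* s)) / (4 ^ s)
                 + (+ s ℤ.* (+ (2 ℕ.* s) ℤ.- + 11)) / (9 ℕ.* 4 ^ s) * fromℕ (n ^ (2 ℕ.* s ∸ 1)) ))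
    =O (λ n → fromℕ (n ^ (2 ℕ.* s ∸ 2)))
-- The threshold is 1 because `IsO` bounds every positive argument.
theorem3p1 s@(suc t) _ = ι K , 1 , error-bound
  where
  instance
    _ = m^n≢0 4 s
    _ = m*n≢0 9 (4 ^ s)
  open ℚₚ.≤-Reasoning
  open IsO (IsO-residual t) renaming (constant to K; bound to residual≤)
  -- In the form `s * 2` the exponent computes to 2 + t * 2, so the truncated subtractions of 1 and
  -- 2 reduce to the exponents of `residual t`.
  2s≡ : 2 ℕ.* s ≡ s ℕ.* 2
  2s≡ = ℕₚ.*-comm 2 s
  expansion : ∀ n →
    β s n - (+ (n ^ (2 ℕ.* s)) / (4 ^ s)
             + (+ s ℤ.* (+ (2 ℕ.* s) ℤ.- + 11)) / (9 ℕ.* 4 ^ s) * fromℕ (n ^ (2 ℕ.* s ∸ 1)))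
    ≡ residual t n
  expansion n = cong₂ _-_ (β≡moment s n) (cong₂ _+_
    (trans (/≡ι*inv (n ^ (2 ℕ.* s)) (4 ^ s))
           (trans (ℚₚ.*-comm (ι (n ^ (2 ℕ.* s))) (α s)) (cong (λ e → α s * ι (n ^ e)) 2s≡)))
    (cong₂ _*_ (coefficient≡γ s)
      (trans (fromℕ≡ι (n ^ (2 ℕ.* s ∸ 1))) (cong (λ e → ι (n ^ (e ∸ 1))) 2s≡))))
  error-bound : ∀ n → 1 ℕ.≤ n →
    ∣ β s n - (+ (n ^ (2 ℕ.* s)) / (4 ^ s)
               + (+ s ℤ.* (+ (2 ℕ.* s) ℤ.- + 11)) / (9 ℕ.* 4 ^ s) * fromℕ (n ^ (2 ℕ.* s ∸ 1))) ∣
    ≤ ι K * ∣ fromℕ (n ^ (2 ℕ.* s ∸ 2)) ∣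
  error-bound n@(suc m) _ = begin
    ∣ β s n - (+ (n ^ (2 ℕ.* s)) / (4 ^ s)
               + (+ s ℤ.* (+ (2 ℕ.* s) ℤ.- + 11)) / (9 ℕ.* 4 ^ s) * fromℕ (n ^ (2 ℕ.* s ∸ 1))) ∣
                                            ≡⟨ cong ∣_∣ (expansion n) ⟩
    ∣ residual t n ∣                      ≤⟨ residual≤ m ⟩
    ι (K ℕ.* n ^ (t ℕ.* 2))               ≡⟨ ι-* K (n ^ (t ℕ.* 2)) ⟩
    ι K * ι (n ^ (t ℕ.* 2))               ≡⟨ cong (λ e → ι K * ι (n ^ (e ∸ 2))) 2s≡ ⟨
    ι K * ι (n ^ (2 ℕ.* s ∸ 2))           ≡⟨ cong (ι K *_) (∣ι∣ (n ^ (2 ℕ.* s ∸ 2))) ⟨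
    ι K * ∣ ι (n ^ (2 ℕ.* s ∸ 2)) ∣       ≡⟨ cong (λ p → ι K * ∣ p ∣) (fromℕ≡ι (n ^ (2 ℕ.* s ∸ 2))) ⟨
    ι K * ∣ fromℕ (n ^ (2 ℕ.* s ∸ 2)) ∣   ∎
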